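{- Let $G$ be a $vgr(n,k,g,\lambda)$-graph with $k\geq 3$, where $g=2h$ is even. Then $$n\ge 2\frac{(k-1)^h-1}{k-2} +\max_{\Lambda\in\left\{\left\lfloor\frac{2\lambda}{k}\right\rfloor,\left\lceil\frac{2\lambda}{k}\right\rceil\right\}}\left\lceil\frac{\left((k-1)^h-\Lambda\right)^2}{2\lambda-3\Lambda+(k-1)^h-2\max\left(0,\left\lceil\frac{\Lambda^2}{2(k-1)^{h-1}}-\frac{\Lambda}{2}\right\rceil\right)}\right\rceil.$$
   Context: A $vgr(n,k,g,\lambda)$-graph is a $k$-regular graph of girth $g$ on $n$ vertices in which every vertex is contained in exactly $\lambda$ cycles of length $g$.
   Formalization: For some graphs (e.g. K_{3,3}: k=3, g=4, λ=6, Λ=4) the fraction is 0/0, so the extra term is claimed only for those Λ whose denominator is positive; the bound n ≥ 2((k−1)^h−1)/(k−2) is stated in all cases. -}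

module Defs where

open import Data.Nat as ℕ using (ℕ; zero; suc; _≤_)
open import Data.Integer as ℤ using (ℤ; +_)
open import Data.Rational as ℚ using (ℚ; 0ℚ; _÷_; floor; ceiling)
open import Data.Rational.Properties as ℚP using ()
open import Data.Fin using (Fin; zero; suc; inject₁; fromℕ)
open import Data.Fin.Properties using (all?) renaming (_≟_ to _≟ᶠ_)
open import Data.Vec using (Vec; []; _∷_; lookup)
open import Data.List using (List; []; _∷_; [_]; map; concatMap; filter; length; allFin)
open import Data.Bool using (Bool; T)
open import Data.Product using (Σ; _×_; _,_)
open import Data.Empty using (⊥)
open import Relation.Binary.PropositionalEquality using (_≡_)
open import Relation.Nullary using (Dec; yes; no; ¬_)
open import Relation.Nullary.Decidable using (T?; _×-dec_; _→-dec_)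

record Graph (n : ℕ) : Set where
  field
    adj    : Fin n → Fin n → Bool
    sym    : ∀ u v → adj u v ≡ adj v u
    irrefl : ∀ v → adj v v ≡ Bool.false
open Graph public

Adj : ∀ {n} → Graph n → Fin n → Fin n → Set
Adj G u v = T (adj G u v)

degree : ∀ {n} → Graph n → Fin n → ℕ
degree {n} G v = length (filter (λ w → T? (adj G v w)) (allFin n))

Regular : ∀ {n} → Graph n → ℕ → Set
Regular {n} G k = ∀ (v : Fin n) → degree G v ≡ k

IsCycle : ∀ {n} → Graph n → (L : ℕ) → Vec (Fin n) L → Set
IsCycle G zero    c = ⊥
IsCycle G (suc m) c =
  (3 ≤ suc m)
  × (∀ i j → lookup c i ≡ lookup c j → i ≡ j)
  × (∀ (i : Fin m) → Adj G (lookup c (inject₁ i)) (lookup c (suc i)))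
  × Adj G (lookup c (fromℕ m)) (lookup c zero)

IsCycle? : ∀ {n} (G : Graph n) (L : ℕ) (c : Vec (Fin n) L) → Dec (IsCycle G L c)
IsCycle? G zero    c = no (λ ())
IsCycle? G (suc m) c =
  (3 ℕ.≤? suc m)
  ×-dec (all? (λ i → all? (λ j → (lookup c i ≟ᶠ lookup c j) →-dec (i ≟ᶠ j))))
  ×-dec (all? (λ i → T? (adj G (lookup c (inject₁ i)) (lookup c (suc i)))))
  ×-dec T? (adj G (lookup c (fromℕ m)) (lookup c zero))

HasGirth : ∀ {n} → Graph n → ℕ → Set
HasGirth {n} G g =
  Σ (Vec (Fin n) g) (IsCycle G g)
  × (∀ (L : ℕ) (c : Vec (Fin n) L) → IsCycle G L c → g ≤ L)

allVecs : (n L : ℕ) → List (Vec (Fin n) L)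
allVecs n zero    = [ [] ]
allVecs n (suc L) = concatMap (λ x → map (x ∷_) (allVecs n L)) (allFin n)

StartsAt : ∀ {n L} → Vec (Fin n) L → Fin n → Set
StartsAt []      v = ⊥
StartsAt (x ∷ _) v = x ≡ v

StartsAt? : ∀ {n L} (c : Vec (Fin n) L) (v : Fin n) → Dec (StartsAt c v)
StartsAt? []      v = no (λ ())
StartsAt? (x ∷ _) v = x ≟ᶠ v

-- number of cyclic sequences of length L that are cycles starting at v.
-- Each (undirected) L-cycle through v is counted exactly twice
-- (once per orientation), so this equals 2 × (# L-cycles through v).
rootedCycles : ∀ {n} → Graph n → ℕ → Fin n → ℕ
rootedCycles {n} G L v =
  length (filter (λ c → IsCycle? G L c ×-dec StartsAt? c v) (allVecs n L))

IsVGR : ∀ {n} → Graph n → (k g λ' : ℕ) → Set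
IsVGR {n} G k g λ' =
  Regular G k × HasGirth G g × (∀ (v : Fin n) → rootedCycles G g v ≡ 2 ℕ.* λ')

-- division in ℚ (only ever used with nonzero denominators below;
-- returns 0 on a zero denominator)
_÷₀_ : ℚ → ℚ → ℚ
p ÷₀ q with q ℚP.≟ 0ℚ
... | yes _  = 0ℚ
... | no q≢0 = _÷_ p q {{ℚ.≢-nonZero q≢0}}

ℤ→ℚ : ℤ → ℚ
ℤ→ℚ z = z ℚ./ 1

ℕ→ℚ : ℕ → ℚ
ℕ→ℚ m = ℤ→ℚ (+ m)

ΛCandidates : (k λ' : ℕ) → List ℤ
ΛCandidates k λ' =
  floor (ℕ→ℚ (2 ℕ.* λ') ÷₀ ℕ→ℚ k) ∷ ceiling (ℕ→ℚ (2 ℕ.* λ') ÷₀ ℕ→ℚ k) ∷ []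

denom : (k h λ' : ℕ) → ℤ → ℤ
denom k h λ' Λ =
  (+ (2 ℕ.* λ') ℤ.- (+ 3) ℤ.* Λ ℤ.+ + ((k ℕ.∸ 1) ℕ.^ h))
  ℤ.- (+ 2) ℤ.* (ℤ.+0 ℤ.⊔ ceiling
        ((ℤ→ℚ (Λ ℤ.* Λ) ÷₀ ℕ→ℚ (2 ℕ.* (k ℕ.∸ 1) ℕ.^ (h ℕ.∸ 1)))
         ℚ.- (ℤ→ℚ Λ ÷₀ ℕ→ℚ 2)))

numer : (k h : ℕ) → ℤ → ℤ
numer k h Λ = (+ ((k ℕ.∸ 1) ℕ.^ h) ℤ.- Λ) ℤ.* (+ ((k ℕ.∸ 1) ℕ.^ h) ℤ.- Λ)

fracTerm : (k h λ' : ℕ) → ℤ → ℤ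
fracTerm k h λ' Λ = ceiling (ℤ→ℚ (numer k h Λ) ÷₀ ℤ→ℚ (denom k h λ' Λ))

mooreTerm : (k h : ℕ) → ℚ
mooreTerm k h =
  ℤ→ℚ (+ 2) ℚ.* (ℤ→ℚ (+ ((k ℕ.∸ 1) ℕ.^ h) ℤ.- + 1) ÷₀ ℕ→ℚ (k ℕ.∸ 2))

{-# OPTIONS --safe #-}
-- Fix a vertex u and write h = g / 2, M = (k − 1)^h, m = (k − 1)^(h − 1).  For an edge u v, the vertices at
-- distance less than h from it form a tree with 2 (M − 1) / (k − 2) vertices; let R be the remaining ones.
-- Let p x be the number of non-backtracking walks of length h from u to x that do not start with v.
-- Walks of length h from u with a common endpoint are the two halves of a g-cycle, and p vanishes on the
-- tree except at the m leaves on the side of v.  If λₑ is the number of g-cycles through u v, it follows that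
--   ∑_R p = M − λₑ   and   ∑_R p² = 2λ − 2λₑ + M − ∑_leaves p²,   ∑_leaves p = λₑ,
-- so by Cauchy–Schwarz, bounding p² ≥ (2r + 1) p − r (r + 1) at the leaves,
--   (M − λₑ)² ≤ |R| (2λ + M − (2r + 3) λₑ + m r (r + 1))   for every natural number r.
-- Since the λₑ at u sum to 2λ, some λₑ is at most 2λ/k and another at least 2λ/k.  The inequality is convex in
-- λₑ, hence also holds with λₑ replaced by Λ, and r = ⌊Λ / m⌋ gives the stated denominator.
module Submission where

open import Defs hiding (sym)
open import Algebra.Properties.Group using (⁻¹-involutive)
open import Data.Bool using (T)
open import Data.Empty using (⊥-elim)
open import Data.Fin using (Fin; zero; suc; inject₁; fromℕ)
open import Data.Fin.Properties as Fin using () renaming (_≟_ to _≟ᶠ_)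
open import Data.Integer.DivMod using ([n/d]*d≤n; n<s[n/ℕd]*d; div-pos-is-/ℕ)
import Data.Integer.Properties as ℤP
import Data.Integer.Tactic.RingSolver as ℤSolver
open import Data.List using (List; []; _∷_; [_]; map; concatMap; filter; length; allFin; _++_; _ʳ++_; drop; cartesianProduct)
open import Data.List.Membership.Propositional using (_∈_; _∉_; find; lose)
open import Data.List.Membership.Propositional.Properties
open import Data.List.Membership.Propositional.Properties.WithK using (unique∧set⇒bag)
open import Data.List.Properties as List using (filter-accept; filter-reject; filter-all; filter-++; length-map; length-++; length-ʳ++; length-tabulate; ≡-dec; ++-identityʳ; ∷ʳ-injectiveˡ; concatMap-++)
open import Data.List.Relation.Binary.BagAndSetEquality using (∼bag⇒↭)
open import Data.List.Relation.Binary.Permutation.Propositional using (_↭_; refl; prep; swap)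
open import Data.List.Relation.Binary.Permutation.Propositional.Properties using (↭-length)
open import Data.List.Relation.Unary.All as All using (All; []; _∷_)
open import Data.List.Relation.Unary.All.Properties using (¬Any⇒All¬; ++⁻ˡ)
open import Data.List.Relation.Unary.AllPairs using ([]; _∷_)
open import Data.List.Relation.Unary.Any using (here; there)
open import Data.List.Relation.Unary.Linked using (Linked; [-]; _∷_)
open import Data.List.Relation.Unary.Unique.DecPropositional using () renaming (unique? to uniqueDec)
open import Data.List.Relation.Unary.Unique.Propositional using (Unique)
open import Data.List.Relation.Unary.Unique.Propositional.Properties as Unique using (Unique[x∷xs]⇒x∉xs)
open import Data.Nat as ℕ using (ℕ; zero; suc; _≤_; _<_; _+_; _*_; _∸_; _^_; z≤n; s≤s)
import Data.Nat.DivMod as ℕD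
open import Data.Nat.Properties
open import Data.Nat.Tactic.RingSolver using (solve-∀)
open import Data.Product using (Σ; ∃; ∃₂; _×_; _,_; proj₁; proj₂)
open import Data.Rational as ℚ using (ℚ; mkℚ; 0ℚ; 1ℚ; floor; ceiling; toℚᵘ)
import Data.Rational.Properties as ℚP
open import Data.Rational.Unnormalised as ℚᵘ using (mkℚᵘ; *≤*; *≡*)
import Data.Rational.Unnormalised.Properties as ℚᵘP
open import Data.Sum using (inj₁; inj₂)
open import Data.Unit using (⊤; tt)
open import Data.Vec using (Vec; []; _∷_; lookup; toList; fromList; head)
open import Data.Vec.Properties using (toList∘fromList; length-toList; toList-injective; cast-is-id)
open import Function using (_∘_; const; mk⇔)
open import Relation.Binary.Definitions using (DecidableEquality; Reflexive; Total; Transitive)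
open import Relation.Binary.PropositionalEquality using (_≡_; _≢_; refl; sym; trans; cong; cong₂; subst; subst₂; module ≡-Reasoning)
open import Relation.Nullary using (Dec; yes; no; ¬_; ¬?; _×-dec_)
open import Relation.Nullary.Decidable using (T?; decidable-stable)
open import Relation.Unary using (Decidable)

-- Because of the girth, each leaf is the end of exactly one walk of length h that starts with v, so
-- every other walk to that leaf closes a g-cycle through u v; this is why the sum of p over the
-- leaves stands for λₑ. The total 2λ appears because ordered pairs of distinct walks correspond to
-- rooted cycles with an orientation. The parameter r stays free until the end for a reason. The
-- denominator of the theorem contains a ceiling and is awkward to interpolate in Λ. For a fixed r
-- the bound on the leaves is linear in λₑ, so the inequality at two edges can be carried to any Λ
-- between them with the same r, and only then is r adapted to Λ. Combining two edges is possible
-- because |R| is the same for all of them. The ceiling itself comes from integrality: m natural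
-- numbers with sum Λ have a sum of binomials C(c, 2) that is smallest when they take only the
-- values r and r + 1. This minimum is an integer not below Λ²/(2m) - Λ/2, the value for equal real
-- numbers, hence not below the ceiling.

private variable
  A B : Set

-- Finite sums

∑ : List A → (A → ℕ) → ℕ
∑ []       f = 0
∑ (x ∷ xs) f = f x + ∑ xs f

+-interchange : ∀ a b c d → (a + b) + (c + d) ≡ (a + c) + (b + d)
+-interchange = solve-∀

∑-cong : ∀ (xs : List A) {f g : A → ℕ} → (∀ {x} → x ∈ xs → f x ≡ g x) → ∑ xs f ≡ ∑ xs g
∑-cong []       eq = refl
∑-cong (x ∷ xs) eq = cong₂ _+_ (eq (here refl)) (∑-cong xs (eq ∘ there))

∑-mono : ∀ (xs : List A) {f g : A → ℕ} → (∀ {x} → x ∈ xs → f x ≤ g x) → ∑ xs f ≤ ∑ xs g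
∑-mono []       le = z≤n
∑-mono (x ∷ xs) le = +-mono-≤ (le (here refl)) (∑-mono xs (le ∘ there))

∑-++ : ∀ (xs {ys} : List A) (f : A → ℕ) → ∑ (xs ++ ys) f ≡ ∑ xs f + ∑ ys f
∑-++ []       f = refl
∑-++ (x ∷ xs) f = trans (cong (f x +_) (∑-++ xs f)) (sym (+-assoc (f x) _ _))

∑-map : ∀ (g : A → B) (xs : List A) (f : B → ℕ) → ∑ (map g xs) f ≡ ∑ xs (f ∘ g)
∑-map g []       f = refl
∑-map g (x ∷ xs) f = cong (f (g x) +_) (∑-map g xs f)

∑-+ : ∀ (xs : List A) (f g : A → ℕ) → ∑ xs (λ x → f x + g x) ≡ ∑ xs f + ∑ xs g
∑-+ []       f g = refl
∑-+ (x ∷ xs) f g = trans (cong (f x + g x +_) (∑-+ xs f g))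
  (+-interchange (f x) (g x) (∑ xs f) (∑ xs g))

∑-*ˡ : ∀ (xs : List A) c (f : A → ℕ) → ∑ xs (λ x → c * f x) ≡ c * ∑ xs f
∑-*ˡ []       c f = sym (*-zeroʳ c)
∑-*ˡ (x ∷ xs) c f = trans (cong (c * f x +_) (∑-*ˡ xs c f)) (sym (*-distribˡ-+ c (f x) _))

∑-const : ∀ (xs : List A) c → ∑ xs (const c) ≡ length xs * c
∑-const []       c = refl
∑-const (x ∷ xs) c = cong (c +_) (∑-const xs c)

∑-0 : ∀ (xs : List A) → ∑ xs (const 0) ≡ 0
∑-0 xs = trans (∑-const xs 0) (*-zeroʳ (length xs))

∑-1 : ∀ (xs : List A) → ∑ xs (const 1) ≡ length xs
∑-1 xs = trans (∑-const xs 1) (*-identityʳ (length xs))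

∑-swap : ∀ (xs : List A) (ys : List B) (f : A → B → ℕ) →
  ∑ xs (λ x → ∑ ys (f x)) ≡ ∑ ys (λ y → ∑ xs (λ x → f x y))
∑-swap []       ys f = sym (∑-0 ys)
∑-swap (x ∷ xs) ys f = trans (cong (∑ ys (f x) +_) (∑-swap xs ys f))
  (sym (∑-+ ys (f x) (λ y → ∑ xs (λ x → f x y))))

∑-↭ : ∀ {xs ys : List A} (f : A → ℕ) → xs ↭ ys → ∑ xs f ≡ ∑ ys f
∑-↭ f refl         = refl
∑-↭ f (prep x p)   = cong (f x +_) (∑-↭ f p)
∑-↭ f (swap {xs} {ys} x y p) = begin
  f x + (f y + ∑ xs f) ≡⟨ +-assoc (f x) (f y) _ ⟨
  f x + f y + ∑ xs f   ≡⟨ cong₂ _+_ (+-comm (f x) (f y)) (∑-↭ f p) ⟩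
  f y + f x + ∑ ys f   ≡⟨ +-assoc (f y) (f x) _ ⟩
  f y + (f x + ∑ ys f) ∎
  where open ≡-Reasoning
∑-↭ f (_↭_.trans p q)  = trans (∑-↭ f p) (∑-↭ f q)

-- The form in which bijections enter: two enumerations without repetition get equal lengths and
-- equal sums from equality as sets.
unique-set⇒↭ : ∀ {xs ys : List A} → Unique xs → Unique ys →
  (∀ {x} → x ∈ xs → x ∈ ys) → (∀ {x} → x ∈ ys → x ∈ xs) → xs ↭ ys
unique-set⇒↭ uxs uys to from = ∼bag⇒↭ (unique∧set⇒bag uxs uys (mk⇔ to from))

-- Injectivity is asked only on `xs`, since taking endpoints or gluing is injective on suitable
-- walks only.
map-unique : ∀ {f : A → B} {xs} → (∀ {x y} → x ∈ xs → y ∈ xs → f x ≡ f y → x ≡ y) →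
  Unique xs → Unique (map f xs)
map-unique {xs = []}     inj []       = []
map-unique {f = f} {xs = x ∷ xs} inj (x∉ ∷ u) =
  ¬Any⇒All¬ _ fresh ∷ map-unique (λ p q → inj (there p) (there q)) u
  where
  fresh : f x ∉ map f xs
  fresh fx∈ with y , y∈ , eq ← ∈-map⁻ f fx∈
            with refl ← inj (here refl) (there y∈) eq = Unique[x∷xs]⇒x∉xs (x∉ ∷ u) y∈

concatMap-unique : ∀ {f : A → List B} {xs} → (∀ {x} → x ∈ xs → Unique (f x)) →
  (∀ {x y z} → z ∈ f x → z ∈ f y → x ≡ y) → Unique xs → Unique (concatMap f xs)
concatMap-unique {xs = []}     uf inj []       = []
concatMap-unique {f = f} {xs = x ∷ xs} uf inj (x∉ ∷ u) =
  Unique.++⁺ (uf (here refl)) (concatMap-unique (uf ∘ there) inj u) disjoint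
  where
  disjoint : ∀ {z} → ¬ (z ∈ f x × z ∈ concatMap f xs)
  disjoint (z∈ , z∈′) with y , y∈ , z∈fy ← find (∈-concatMap⁻ f z∈′)
                      with refl ← inj z∈ z∈fy = Unique[x∷xs]⇒x∉xs (x∉ ∷ u) y∈

module _ (_≟_ : DecidableEquality A) where

  length-remove : ∀ {y} {xs : List A} → Unique xs → y ∈ xs →
    suc (length (filter (λ z → ¬? (z ≟ y)) xs)) ≡ length xs
  length-remove {y} {x ∷ xs} u@(x∉ ∷ ux) (here refl) =
    cong suc (cong length (trans
      (filter-reject (λ z → ¬? (z ≟ y)) {xs = xs} (λ ¬eq → ¬eq refl))
      (filter-all (λ z → ¬? (z ≟ y)) (All.map (λ ne eq → ne (sym eq)) x∉))))
  length-remove {y} {x ∷ xs} u@(x∉ ∷ ux) (there y∈) =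
    cong suc (trans
      (cong length (filter-accept (λ z → ¬? (z ≟ y)) {xs = xs} (λ { refl → Unique[x∷xs]⇒x∉xs u y∈ })))
      (length-remove ux y∈))

  δ : A → A → ℕ
  δ x y with x ≟ y
  ... | yes _ = 1
  ... | no  _ = 0

  δ-≡ : ∀ x → δ x x ≡ 1
  δ-≡ x with x ≟ x
  ... | yes _ = refl
  ... | no ne = ⊥-elim (ne refl)

  δ-≢ : ∀ {x y} → x ≢ y → δ x y ≡ 0
  δ-≢ {x} {y} ne with x ≟ y
  ... | yes eq = ⊥-elim (ne eq)
  ... | no  _  = refl

  -- The multiplicity of an entry, written as a sum so that double counting becomes an exchange of
  -- sums.
  mult : List A → A → ℕ
  mult xs y = ∑ xs (λ x → δ x y)

  mult-∉ : ∀ xs {y} → y ∉ xs → mult xs y ≡ 0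
  mult-∉ xs y∉ = trans
    (∑-cong xs (λ x∈ → δ-≢ λ { refl → y∉ x∈ })) (∑-0 xs)

  mult≤1 : ∀ {xs} → Unique xs → ∀ y → mult xs y ≤ 1
  mult≤1 {[]}     u        y = z≤n
  mult≤1 {x ∷ xs} u@(_ ∷ ux) y with x ≟ y
  ... | yes refl rewrite mult-∉ xs (Unique[x∷xs]⇒x∉xs u) = ≤-refl
  ... | no _     = mult≤1 ux y

  mult-filter : ∀ {C : Set} (f : C → A) xs y → mult (map f xs) y ≡ length (filter (λ x → f x ≟ y) xs)
  mult-filter f []       y = refl
  mult-filter f (x ∷ xs) y with f x ≟ y
  ... | yes eq rewrite mult-filter f xs y = refl
  ... | no  _  = mult-filter f xs y

  ∑-δ : ∀ {xs y} (f : A → ℕ) → Unique xs → y ∈ xs → ∑ xs (λ x → f x * δ y x) ≡ f y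
  ∑-δ {x ∷ xs} {y} f u@(_ ∷ ux) (here refl) rewrite δ-≡ x = begin
    f x * 1 + ∑ xs (λ z → f z * δ x z) ≡⟨ cong₂ _+_ (*-identityʳ (f x)) (∑-cong xs zero′) ⟩
    f x + ∑ xs (const 0)               ≡⟨ cong (f x +_) (∑-0 xs) ⟩
    f x + 0                            ≡⟨ +-identityʳ (f x) ⟩
    f x                                ∎
    where
    open ≡-Reasoning
    zero′ : ∀ {z} → z ∈ xs → f z * δ x z ≡ 0
    zero′ {z} z∈ rewrite δ-≢ {x} {z} (λ { refl → Unique[x∷xs]⇒x∉xs u z∈ }) = *-zeroʳ (f z)
  ∑-δ {x ∷ xs} {y} f u@(_ ∷ ux) (there y∈)
    rewrite δ-≢ {y} {x} (λ { refl → Unique[x∷xs]⇒x∉xs u y∈ }) | *-zeroʳ (f x) = ∑-δ f ux y∈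

  -- The bridge between sums over walks, through the list of their ends, and sums over all vertices.
  ∑-mult : ∀ {xs} (f : A → ℕ) ys → Unique xs → (∀ y → y ∈ xs) →
    ∑ xs (λ x → f x * mult ys x) ≡ ∑ ys f
  ∑-mult {xs} f ys u all∈ = begin
    ∑ xs (λ x → f x * mult ys x)              ≡⟨ ∑-cong xs (λ {x} _ → sym (∑-*ˡ ys (f x) (λ y → δ y x))) ⟩
    ∑ xs (λ x → ∑ ys (λ y → f x * δ y x))     ≡⟨ ∑-swap xs ys (λ x y → f x * δ y x) ⟩
    ∑ ys (λ y → ∑ xs (λ x → f x * δ y x))     ≡⟨ ∑-cong ys (λ {y} _ → ∑-δ f u (all∈ y)) ⟩
    ∑ ys f                                    ∎
    where open ≡-Reasoning

-- The excess is the square of the difference `d`; writing the larger number as the smaller plus `d`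
-- avoids truncated subtraction.
2ab≤a²+b² : ∀ a b → 2 * (a * b) ≤ a * a + b * b
2ab≤a²+b² a b with ≤-total a b
... | inj₁ a≤b with d , refl ← m≤n⇒∃[o]m+o≡n a≤b = ≤-trans (m≤m+n _ (d * d)) (≤-reflexive (identity a d))
  where
  identity : ∀ a d → 2 * (a * (a + d)) + d * d ≡ a * a + (a + d) * (a + d)
  identity = solve-∀
... | inj₂ b≤a with d , refl ← m≤n⇒∃[o]m+o≡n b≤a = ≤-trans (m≤m+n _ (d * d)) (≤-reflexive (identity b d))
  where
  identity : ∀ b d → 2 * ((b + d) * b) + d * d ≡ (b + d) * (b + d) + b * b
  identity = solve-∀

-- In the induction step the cross term `2 * a * S` is a sum of terms `2 * (a * f y)`, each at most
-- `a * a + f y * f y`.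
cauchy-schwarz : ∀ (xs : List A) f → ∑ xs f * ∑ xs f ≤ length xs * ∑ xs (λ x → f x * f x)
cauchy-schwarz []       f = z≤n
cauchy-schwarz (x ∷ xs) f = begin
  (a + S) * (a + S)                   ≡⟨ expand a S ⟩
  a * a + (2 * a * S + S * S)         ≤⟨ +-monoʳ-≤ (a * a) (+-mono-≤ cross (cauchy-schwarz xs f)) ⟩
  a * a + (l * (a * a) + Q + l * Q)   ≡⟨ collect a l Q ⟩
  (1 + l) * (a * a + Q)               ∎
  where
  open ≤-Reasoning
  a = f x; S = ∑ xs f; l = length xs; Q = ∑ xs (λ x → f x * f x)
  expand : ∀ a S → (a + S) * (a + S) ≡ a * a + (2 * a * S + S * S)
  expand = solve-∀
  collect : ∀ a l Q → a * a + (l * (a * a) + Q + l * Q) ≡ (1 + l) * (a * a + Q)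
  collect = solve-∀
  cross : 2 * a * S ≤ l * (a * a) + Q
  cross = begin
    2 * a * S                           ≡⟨ ∑-*ˡ xs (2 * a) f ⟨
    ∑ xs (λ y → 2 * a * f y)            ≤⟨ ∑-mono xs (λ {y} _ → ≤-trans (≤-reflexive (*-assoc 2 a (f y))) (2ab≤a²+b² a (f y))) ⟩
    ∑ xs (λ y → a * a + f y * f y)      ≡⟨ ∑-+ xs (const (a * a)) (λ y → f y * f y) ⟩
    ∑ xs (const (a * a)) + Q            ≡⟨ cong (_+ Q) (∑-const xs (a * a)) ⟩
    l * (a * a) + Q                     ∎

-- (c − r)(c − r − 1) ≥ 0 for integers.
tangent : ∀ r c → (2 * r + 1) * c ≤ c * c + r * suc r
tangent r c with ≤-total c r
... | inj₁ c≤r with d , refl ← m≤n⇒∃[o]m+o≡n c≤r = ≤-trans (m≤m+n _ (d * d + d)) (≤-reflexive (identity c d))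
  where
  identity : ∀ c d → (2 * (c + d) + 1) * c + (d * d + d) ≡ c * c + (c + d) * (1 + (c + d))
  identity = solve-∀
... | inj₂ r≤c with m≤n⇒∃[o]m+o≡n r≤c
...   | zero  , refl = ≤-reflexive (identity r)
  where
  identity : ∀ r → (2 * r + 1) * (r + 0) ≡ (r + 0) * (r + 0) + r * (1 + r)
  identity = solve-∀
...   | suc d , refl = ≤-trans (m≤m+n _ (d * d + d)) (≤-reflexive (identity r d))
  where
  identity : ∀ r d → (2 * r + 1) * (r + (1 + d)) + (d * d + d) ≡ (r + (1 + d)) * (r + (1 + d)) + r * (1 + r)
  identity = solve-∀

∑-tangent : ∀ (xs : List A) r f → (2 * r + 1) * ∑ xs f ≤ ∑ xs (λ x → f x * f x) + length xs * (r * suc r)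
∑-tangent xs r f = begin
  (2 * r + 1) * ∑ xs f                      ≡⟨ ∑-*ˡ xs (2 * r + 1) f ⟨
  ∑ xs (λ x → (2 * r + 1) * f x)            ≤⟨ ∑-mono xs (λ {x} _ → tangent r (f x)) ⟩
  ∑ xs (λ x → f x * f x + r * suc r)        ≡⟨ ∑-+ xs (λ x → f x * f x) (const (r * suc r)) ⟩
  _ + ∑ xs (const (r * suc r))              ≡⟨ cong (_ +_) (∑-const xs (r * suc r)) ⟩
  _                                         ∎
  where open ≤-Reasoning

-- An arbitrary total preorder `R` lets one proof give the minimum and, with the order reversed, the
-- maximum.
extremum : ∀ {R : ℕ → ℕ → Set} → Reflexive R → Total R → Transitive R → (f : A → ℕ) → ∀ x xs →
  Σ A λ y → y ∈ x ∷ xs × All (λ z → R (f y) (f z)) (x ∷ xs)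
extremum rfl total trns f x [] = x , here refl , rfl ∷ []
extremum rfl total trns f x (x′ ∷ xs) with extremum rfl total trns f x′ xs
... | y , y∈ , all with total (f x) (f y)
...   | inj₁ r = x , here refl , rfl ∷ All.map (trns r) all
...   | inj₂ r = y , there y∈ , r ∷ all

below-average : ∀ (f : A → ℕ) xs → 0 < length xs → Σ A λ y → y ∈ xs × length xs * f y ≤ ∑ xs f
below-average f (x ∷ xs) _ with y , y∈ , all ← extremum ≤-refl ≤-total ≤-trans f x xs =
  y , y∈ , subst (_≤ ∑ (x ∷ xs) f) (∑-const (x ∷ xs) (f y)) (∑-mono (x ∷ xs) (λ z∈ → All.lookup all z∈))

above-average : ∀ (f : A → ℕ) xs → 0 < length xs → Σ A λ y → y ∈ xs × ∑ xs f ≤ length xs * f y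
above-average f (x ∷ xs) _ with y , y∈ , all ← extremum ≤-refl (λ a b → ≤-total b a) (λ p q → ≤-trans q p) f x xs =
  y , y∈ , subst (∑ (x ∷ xs) f ≤_) (∑-const (x ∷ xs) (f y)) (∑-mono (x ∷ xs) (λ z∈ → All.lookup all z∈))

-- Lists and vectors

module _ {A : Set} where

  ʳ++-injective : ∀ (xs xs′ : List A) {ys ys′} → xs ʳ++ ys ≡ xs′ ʳ++ ys′ → length xs ≡ length xs′ →
    xs ≡ xs′ × ys ≡ ys′
  ʳ++-injective []       []         eq len = refl , eq
  ʳ++-injective (x ∷ xs) (x′ ∷ xs′) eq len with ʳ++-injective xs xs′ eq (suc-injective len)
  ... | refl , refl = refl , refl

  -- Walks grow at the head of the list, so the vertex where a walk starts is the last entry.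
  data EndsAt (u : A) : List A → Set where
    here  : EndsAt u (u ∷ [])
    there : ∀ {x l} → EndsAt u l → EndsAt u (x ∷ l)

  endsAt⇒∈ : ∀ {u l} → EndsAt u l → u ∈ l
  endsAt⇒∈ here      = here refl
  endsAt⇒∈ (there e) = there (endsAt⇒∈ e)

  endsAt⇒snoc : ∀ {u l} → EndsAt u l → ∃ λ c → l ≡ c ++ [ u ]
  endsAt⇒snoc here = [] , refl
  endsAt⇒snoc (there {x} e) with c , refl ← endsAt⇒snoc e = x ∷ c , refl

  snoc-endsAt : ∀ {u} l → EndsAt u (l ++ [ u ])
  snoc-endsAt []      = here
  snoc-endsAt (x ∷ l) = there (snoc-endsAt l)

  ʳ++-endsAt : ∀ {u xs zs} → EndsAt u xs → EndsAt u zs → ∃ λ ys → xs ʳ++ zs ≡ u ∷ ys × EndsAt u ys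
  ʳ++-endsAt {zs = zs} here e = zs , refl , e
  ʳ++-endsAt (there e) e′ = ʳ++-endsAt e (there e′)

  endpoint : A → List A → A
  endpoint d []      = d
  endpoint d (x ∷ _) = x

  toList-surjective : ∀ {m} (l : List A) → length l ≡ m → ∃ λ (c : Vec A m) → toList c ≡ l
  toList-surjective l refl = fromList l , toList∘fromList l

  lookup∈toList : ∀ {m} (c : Vec A m) i → lookup c i ∈ toList c
  lookup∈toList (x ∷ c) zero    = here refl
  lookup∈toList (x ∷ c) (suc i) = there (lookup∈toList c i)

  ∈toList⇒lookup : ∀ {m x} (c : Vec A m) → x ∈ toList c → ∃ λ i → lookup c i ≡ x
  ∈toList⇒lookup (x ∷ c) (here refl) = zero , refl
  ∈toList⇒lookup (x ∷ c) (there x∈) with i , eq ← ∈toList⇒lookup c x∈ = suc i , eq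

  unique⇒lookup-injective : ∀ {m} (c : Vec A m) → Unique (toList c) → ∀ i j → lookup c i ≡ lookup c j → i ≡ j
  unique⇒lookup-injective (x ∷ c) u zero zero eq = refl
  unique⇒lookup-injective (x ∷ c) u zero (suc j) refl = ⊥-elim (Unique[x∷xs]⇒x∉xs u (lookup∈toList c j))
  unique⇒lookup-injective (x ∷ c) u (suc i) zero refl = ⊥-elim (Unique[x∷xs]⇒x∉xs u (lookup∈toList c i))
  unique⇒lookup-injective (x ∷ c) (_ ∷ u) (suc i) (suc j) eq = cong suc (unique⇒lookup-injective c u i j eq)

  lookup-injective⇒unique : ∀ {m} (c : Vec A m) → (∀ i j → lookup c i ≡ lookup c j → i ≡ j) → Unique (toList c)
  lookup-injective⇒unique []      inj = []
  lookup-injective⇒unique (x ∷ c) inj =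
    ¬Any⇒All¬ _ fresh ∷ lookup-injective⇒unique c (λ i j eq → Fin.suc-injective (inj (suc i) (suc j) eq))
    where
    fresh : x ∉ toList c
    fresh x∈ with i , eq ← ∈toList⇒lookup c x∈ with () ← inj zero (suc i) (sym eq)

-- Together with `allVecs-unique` this makes the filtered list in `rootedCycles` an enumeration of
-- the rooted cycles without repetition.
allVecs-complete : ∀ {n} L (c : Vec (Fin n) L) → c ∈ allVecs n L
allVecs-complete zero    []      = here refl
allVecs-complete (suc L) (x ∷ c) =
  ∈-concatMap⁺ _ (lose (∈-allFin x) (∈-map⁺ (x ∷_) (allVecs-complete L c)))

allVecs-unique : ∀ n L → Unique (allVecs n L)
allVecs-unique n zero    = [] ∷ []
allVecs-unique n (suc L) = concatMap-unique
  (λ _ → Unique.map⁺ (λ { refl → refl }) (allVecs-unique n L))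
  (λ {x} {y} p q → same-head (∈-map⁻ (x ∷_) p) (∈-map⁻ (y ∷_) q))
  (Unique.allFin⁺ n)
  where
  same-head : ∀ {x y z} → (∃ λ c → c ∈ allVecs n L × z ≡ x ∷ c) → (∃ λ c → c ∈ allVecs n L × z ≡ y ∷ c) → x ≡ y
  same-head (_ , _ , refl) (_ , _ , refl) = refl

-- Non-backtracking walks

module Walks {n : ℕ} (G : Graph n) where

  V : Set
  V = Fin n

  _∼_ : V → V → Set
  _∼_ = Adj G

  ∼-sym : ∀ {x y} → x ∼ y → y ∼ x
  ∼-sym {x} {y} = subst T (Graph.sym G x y)

  ∼-irrefl : ∀ {x} → ¬ x ∼ x
  ∼-irrefl {x} = subst T (Graph.irrefl G x)

  -- Walks are listed backwards: the head of the list is the last vertex reached.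
  data NB : List V → Set where
    single : ∀ {x} → NB (x ∷ [])
    edge   : ∀ {x y} → x ∼ y → NB (x ∷ y ∷ [])
    step   : ∀ {x y z l} → x ∼ y → x ≢ z → NB (y ∷ z ∷ l) → NB (x ∷ y ∷ z ∷ l)

  NB-tail : ∀ {x y l} → NB (x ∷ y ∷ l) → NB (y ∷ l)
  NB-tail (edge _)      = single
  NB-tail (step _ _ nb) = nb

  NB-adj : ∀ {x y l} → NB (x ∷ y ∷ l) → x ∼ y
  NB-adj (edge a)     = a
  NB-adj (step a _ _) = a

  NB⇒Linked : ∀ {l} → NB l → Linked _∼_ l
  NB⇒Linked single        = [-]
  NB⇒Linked (edge a)      = a ∷ [-]
  NB⇒Linked (step a _ nb) = a ∷ NB⇒Linked nb

  -- For the tails of two walks with a common head: the non-backtracking condition at that head when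
  -- one walk is reversed onto the other. An empty tail imposes nothing.
  Apart : List V → List V → Set
  Apart (x ∷ _) (y ∷ _) = x ≢ y
  Apart _       _       = ⊤

  NB-cons : ∀ {x y l l′} → x ∼ y → NB (y ∷ l) → Apart l (x ∷ l′) → NB (x ∷ y ∷ l)
  NB-cons {l = []}    a nb _  = edge a
  NB-cons {l = _ ∷ _} a nb ne = step a (ne ∘ sym) nb

  NB-apart : ∀ {x y l l′} → NB (x ∷ y ∷ l) → Apart (x ∷ l′) l
  NB-apart (edge _)      = tt
  NB-apart (step _ ne _) = ne

  Apart-sym : ∀ l l′ → Apart l l′ → Apart l′ l
  Apart-sym []      []      p = tt
  Apart-sym []      (_ ∷ _) p = tt
  Apart-sym (_ ∷ _) []      p = tt
  Apart-sym (_ ∷ _) (_ ∷ _) p = p ∘ sym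

  -- Vertices pass one at a time from the first walk to the second. `Apart` at the current junction
  -- is the invariant, renewed by the non-backtracking of the first walk.
  NB-join : ∀ {x} xs {ys} → NB (x ∷ xs) → NB (x ∷ ys) → Apart xs ys → NB (xs ʳ++ (x ∷ ys))
  NB-join []       nb nb′ ap = nb′
  NB-join {x} (y ∷ xs) {ys} nb nb′ ap =
    NB-join xs (NB-tail nb) (NB-cons (∼-sym (NB-adj nb)) nb′ (Apart-sym (y ∷ xs) ys ap)) (Apart-sym (x ∷ ys) xs (NB-apart nb))

  -- The converse of `NB-join`: the junction moves `i` places along the joined list, which itself
  -- does not change. It serves to cut a rooted cycle in half.
  NB-split : ∀ i st {b rest u} → NB (b ∷ st) → NB (b ∷ rest) → Apart st rest → i ≤ length rest →
    EndsAt u (b ∷ st) → EndsAt u (b ∷ rest) →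
    ∃ λ st′ → ∃₂ λ b′ rest′ → st′ ʳ++ (b′ ∷ rest′) ≡ st ʳ++ (b ∷ rest)
      × NB (b′ ∷ st′) × NB (b′ ∷ rest′) × Apart st′ rest′
      × length st′ ≡ i + length st × length rest ≡ i + length rest′
      × EndsAt u (b′ ∷ st′) × EndsAt u (b′ ∷ rest′)
  NB-split zero st nb nb′ ap _ e e′ = st , _ , _ , refl , nb , nb′ , ap , refl , refl , e , e′
  NB-split (suc i) st {b} {r ∷ rest} nb nb′ ap (s≤s i≤) e (there e′)
    with st′ , b′ , rest′ , eq , p , q , ap′ , l , l′ , f , f′ ←
         NB-split i (b ∷ st) (NB-cons {l′ = rest} (∼-sym (NB-adj nb′)) nb ap) (NB-tail nb′) (NB-apart nb′) i≤ (there e) e′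
    = st′ , b′ , rest′ , eq , p , q , ap′ , trans l (+-suc i _) , cong suc l′ , f , f′

  linked⇒lookup : ∀ {m} (c : Vec V (suc m)) {v} → Linked _∼_ (toList c ++ [ v ]) →
    (∀ i → lookup c (inject₁ i) ∼ lookup c (suc i)) × lookup c (fromℕ m) ∼ v
  linked⇒lookup (x ∷ [])    (a ∷ _) = (λ ()) , a
  linked⇒lookup (x ∷ y ∷ c) (a ∷ l) with f , z ← linked⇒lookup (y ∷ c) l =
    (λ { zero → a ; (suc i) → f i }) , z

  lookup⇒linked : ∀ {m} (c : Vec V (suc m)) {v} → (∀ i → lookup c (inject₁ i) ∼ lookup c (suc i)) →
    lookup c (fromℕ m) ∼ v → Linked _∼_ (toList c ++ [ v ])
  lookup⇒linked (x ∷ [])    f z = z ∷ [-]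
  lookup⇒linked (x ∷ y ∷ c) f z = f zero ∷ lookup⇒linked (y ∷ c) (f ∘ suc) z

  isCycle-intro : ∀ {m} (c : Vec V (suc m)) → 3 ≤ suc m → Unique (toList c) →
    Linked _∼_ (toList c ++ [ head c ]) → IsCycle G (suc m) c
  isCycle-intro c@(_ ∷ _) 3≤ u l with f , z ← linked⇒lookup c l = 3≤ , unique⇒lookup-injective c u , f , z

  unique-++ˡ : ∀ (xs {ys} : List V) → Unique (xs ++ ys) → Unique xs
  unique-++ˡ []       u       = []
  unique-++ˡ (x ∷ xs) (x∉ ∷ u) = ++⁻ˡ xs x∉ ∷ unique-++ˡ xs u

  NB-prefix : ∀ x l l′ → NB (x ∷ l ++ l′) → NB (x ∷ l)
  NB-prefix x [] l′ nb = single
  NB-prefix x (y ∷ []) l′ nb = edge (NB-adj nb)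
  NB-prefix x (y ∷ z ∷ l) l′ (step a ne nb) = step a ne (NB-prefix y (z ∷ l) l′ nb)

  unique? : (l : List V) → Dec (Unique l)
  unique? = uniqueDec _≟ᶠ_

  -- Distinctness after the first `x` makes the loop simple. Length 1 would be an edge from `x` to
  -- itself and length 2 a backtrack, so the length is at least 3.
  first-return : ∀ x pre post → NB (x ∷ pre ++ x ∷ post) → Unique (pre ++ x ∷ post) →
    IsCycle G (suc (length pre)) (fromList (x ∷ pre))
  first-return x pre post nb u = isCycle-intro (fromList (x ∷ pre)) (long pre nb)
    (subst Unique (sym (toList∘fromList (x ∷ pre))) (¬Any⇒All¬ _ (fresh pre u) ∷ unique-++ˡ pre u))
    (subst (λ l → Linked _∼_ (l ++ [ x ])) (sym (toList∘fromList (x ∷ pre)))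
      (NB⇒Linked (NB-prefix x (pre ++ [ x ]) post (subst (λ l → NB (x ∷ l)) (sym (List.++-assoc pre [ x ] post)) nb))))
    where
    fresh : ∀ pre → Unique (pre ++ x ∷ post) → x ∉ pre
    fresh (y ∷ pre) u@(_ ∷ _) (here refl) = Unique[x∷xs]⇒x∉xs u (∈-++⁺ʳ pre (here refl))
    fresh (y ∷ pre) (_ ∷ u) (there x∈) = fresh pre u x∈
    long : ∀ pre → NB (x ∷ pre ++ x ∷ post) → 3 ≤ suc (length pre)
    long []              nb            = ⊥-elim (∼-irrefl (NB-adj nb))
    long (y ∷ [])        (step _ ne _) = ⊥-elim (ne refl)
    long (y ∷ z ∷ pre)   nb            = s≤s (s≤s (s≤s z≤n))

  open import Data.List.Membership.DecPropositional {A = V} _≟ᶠ_ using (_∈?_)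

  ShortCycle : ℕ → Set
  ShortCycle m = ∃₂ λ L c → IsCycle G L c × L < m

  -- `rec` descends to the shortest suffix with a repetition. There the entries after the head are
  -- distinct, so it is the head that recurs, and the loop back to it is a cycle.
  short-cycle-cons : ∀ x l → NB (x ∷ l) → ¬ Unique (x ∷ l) →
    (¬ Unique l → ShortCycle (length l)) → ShortCycle (length (x ∷ l))
  short-cycle-cons x l nb ¬u rec with unique? l | x ∈? l
  ... | no ¬u′ | _ with L , c , cyc , L< ← rec ¬u′ = L , c , cyc , m≤n⇒m≤1+n L<
  ... | yes u | no x∉ = ⊥-elim (¬u (¬Any⇒All¬ _ x∉ ∷ u))
  ... | yes u | yes x∈ with pre , post , eq ← ∈-∃++ x∈ =
    suc (length pre) , fromList (x ∷ pre) ,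
    first-return x pre post (subst (λ l → NB (x ∷ l)) eq nb) (subst Unique eq u) ,
    s≤s (subst (suc (length pre) ≤_) (cong length (sym eq)) len)
    where
    len : suc (length pre) ≤ length (pre ++ x ∷ post)
    len = subst (suc (length pre) ≤_)
      (sym (trans (length-++ pre) (+-suc (length pre) (length post)))) (s≤s (m≤m+n _ _))

  short-cycle : ∀ l → NB l → ¬ Unique l → ShortCycle (length l)
  short-cycle (x ∷ [])    nb ¬u = ⊥-elim (¬u ([] ∷ []))
  short-cycle (x ∷ y ∷ l) nb ¬u =
    short-cycle-cons x (y ∷ l) nb ¬u (short-cycle (y ∷ l) (NB-tail nb))

-- Enumeration of non-backtracking walks by successive extension

∑-∈ : ∀ {A : Set} {x : A} {xs} (f : A → ℕ) → x ∈ xs → f x ≤ ∑ xs f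
∑-∈ f (here refl)         = m≤m+n _ _
∑-∈ f (there {x = y} x∈)  = ≤-trans (∑-∈ f x∈) (m≤n+m _ (f y))

length-concatMap : ∀ {A B : Set} (f : A → List B) xs → length (concatMap f xs) ≡ ∑ xs (length ∘ f)
length-concatMap f []       = refl
length-concatMap f (x ∷ xs) = trans (length-++ (f x)) (cong (length (f x) +_) (length-concatMap f xs))

module Enumeration {n : ℕ} (G : Graph n) where

  open Walks G public

  nbrs : V → List V
  nbrs x = filter (λ w → T? (adj G x w)) (allFin n)

  nbrs-unique : ∀ x → Unique (nbrs x)
  nbrs-unique x = Unique.filter⁺ (λ w → T? (adj G x w)) (Unique.allFin⁺ n)

  ∈-nbrs : ∀ {x z} → x ∼ z → z ∈ nbrs x
  ∈-nbrs {x} {z} a = ∈-filter⁺ (λ w → T? (adj G x w)) (∈-allFin z) a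

  nbrs-∈ : ∀ {x z} → z ∈ nbrs x → x ∼ z
  nbrs-∈ {x} z∈ = proj₂ (∈-filter⁻ (λ w → T? (adj G x w)) {xs = allFin n} z∈)

  next : List V → List V
  next []          = []
  next (x ∷ [])    = nbrs x
  next (x ∷ y ∷ _) = filter (λ z → ¬? (z ≟ᶠ y)) (nbrs x)

  next-unique : ∀ w → Unique (next w)
  next-unique []          = []
  next-unique (x ∷ [])    = nbrs-unique x
  next-unique (x ∷ y ∷ _) = Unique.filter⁺ (λ z → ¬? (z ≟ᶠ y)) (nbrs-unique x)

  next-NB : ∀ {z w} → NB w → z ∈ next w → NB (z ∷ w)
  next-NB {w = x ∷ []}    nb z∈ = edge (∼-sym (nbrs-∈ z∈))
  next-NB {w = x ∷ y ∷ l} nb z∈ with z∈′ , ne ← ∈-filter⁻ (λ z → ¬? (z ≟ᶠ y)) {xs = nbrs x} z∈ =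
    step (∼-sym (nbrs-∈ z∈′)) ne nb

  NB-next : ∀ {z x l} → NB (z ∷ x ∷ l) → z ∈ next (x ∷ l)
  NB-next (edge a) = ∈-nbrs (∼-sym a)
  NB-next {l = y ∷ _} (step a ne _) = ∈-filter⁺ (λ z → ¬? (z ≟ᶠ y)) (∈-nbrs (∼-sym a)) ne

  length-next : ∀ {x y l} → NB (x ∷ y ∷ l) → suc (length (next (x ∷ y ∷ l))) ≡ degree G x
  length-next {x} nb = length-remove _≟ᶠ_ (nbrs-unique x) (∈-nbrs (NB-adj nb))

  extend : List V → List (List V)
  extend w = map (_∷ w) (next w)

  ext : ℕ → List (List V) → List (List V)
  ext zero    ws = ws
  ext (suc i) ws = concatMap extend (ext i ws)

  ext-suc⁻ : ∀ i ws {w} → w ∈ ext (suc i) ws → ∃₂ λ z w′ → w ≡ z ∷ w′ × w′ ∈ ext i ws × z ∈ next w′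
  ext-suc⁻ i ws w∈ with w′ , w′∈ , p ← find (∈-concatMap⁻ extend w∈)
                   with z , z∈ , eq ← ∈-map⁻ (_∷ w′) p = z , w′ , eq , w′∈ , z∈

  record Walk (u : V) (i : ℕ) (w : List V) : Set where
    constructor walk
    field
      nb   : NB w
      ends : EndsAt u w
      len  : length w ≡ suc i

  trivial-walk : ∀ u → Walk u 0 (u ∷ [])
  trivial-walk u = walk single here refl

  edge-walk : ∀ {u a} → u ∼ a → Walk u 1 (a ∷ u ∷ [])
  edge-walk a = walk (edge (∼-sym a)) (there here) refl

  ext-walk : ∀ {u j w₀} i {w} → Walk u j w₀ → w ∈ ext i (w₀ ∷ []) → Walk u (i + j) w
  ext-walk zero W (here refl) = W
  ext-walk {w₀ = w₀} (suc i) W w∈ with z , w′ , refl , w′∈ , z∈ ← ext-suc⁻ i (w₀ ∷ []) w∈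
    with walk nb e l ← ext-walk i W w′∈ = walk (next-NB nb z∈) (there e) (cong suc l)

  ext-complete : ∀ {u} i {w} → Walk u i w → w ∈ ext i ((u ∷ []) ∷ [])
  ext-complete zero    (walk _ here _) = here refl
  ext-complete zero    (walk _ (there here) ())
  ext-complete zero    (walk _ (there (there _)) ())
  ext-complete (suc i) {_ ∷ x ∷ l} (walk nb (there e) len) = ∈-concatMap⁺ extend
    (lose (ext-complete i (walk (NB-tail nb) e (suc-injective len))) (∈-map⁺ (_∷ x ∷ l) (NB-next nb)))

  ext-unique : ∀ i {ws} → Unique ws → Unique (ext i ws)
  ext-unique zero    u = u
  ext-unique (suc i) u = concatMap-unique
    (λ {w} _ → Unique.map⁺ (λ { refl → refl }) (next-unique w))
    (λ {w} {w′} p q → same-tail (∈-map⁻ (_∷ w) p) (∈-map⁻ (_∷ w′) q)) (ext-unique i u)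
    where
    same-tail : ∀ {w w′ z} → (∃ λ c → c ∈ next w × z ≡ c ∷ w) → (∃ λ c → c ∈ next w′ × z ≡ c ∷ w′) → w ≡ w′
    same-tail (_ , _ , refl) (_ , _ , refl) = refl

  -- `ext` recurses on the last step of a walk; this exposes the first step, so that the walks from
  -- `u` can be sorted by the neighbour they start with.
  ext-shift : ∀ i ws → ext (suc i) ws ≡ ext i (concatMap extend ws)
  ext-shift zero    ws = refl
  ext-shift (suc i) ws = cong (concatMap extend) (ext-shift i ws)

  ext-++ : ∀ i ws ws′ → ext i (ws ++ ws′) ≡ ext i ws ++ ext i ws′
  ext-++ zero    ws ws′ = refl
  ext-++ (suc i) ws ws′ = trans (cong (concatMap extend) (ext-++ i ws ws′)) (concatMap-++ extend (ext i ws) (ext i ws′))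

  ext-[] : ∀ i → ext i [] ≡ []
  ext-[] zero    = refl
  ext-[] (suc i) = cong (concatMap extend) (ext-[] i)

  ∑-ext : ∀ i ws f → ∑ (ext i ws) f ≡ ∑ ws (λ w → ∑ (ext i (w ∷ [])) f)
  ∑-ext i []       f = cong (λ ws → ∑ ws f) (ext-[] i)
  ∑-ext i (w ∷ ws) f = begin
    ∑ (ext i (w ∷ ws)) f                        ≡⟨ cong (λ l → ∑ l f) (ext-++ i (w ∷ []) ws) ⟩
    ∑ (ext i (w ∷ []) ++ ext i ws) f            ≡⟨ ∑-++ (ext i (w ∷ [])) f ⟩
    ∑ (ext i (w ∷ [])) f + ∑ (ext i ws) f       ≡⟨ cong (∑ (ext i (w ∷ [])) f +_) (∑-ext i ws f) ⟩
    _                                           ∎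
    where open ≡-Reasoning

  ∑-ext-trivial : ∀ i u f → ∑ (ext (suc i) ((u ∷ []) ∷ [])) f ≡ ∑ (nbrs u) (λ a → ∑ (ext i ((a ∷ u ∷ []) ∷ [])) f)
  ∑-ext-trivial i u f = begin
    ∑ (ext (suc i) ((u ∷ []) ∷ [])) f                  ≡⟨ cong (λ l → ∑ l f) (ext-shift i ((u ∷ []) ∷ [])) ⟩
    ∑ (ext i (extend (u ∷ []) ++ [])) f                ≡⟨ cong (λ l → ∑ (ext i l) f) (++-identityʳ (extend (u ∷ []))) ⟩
    ∑ (ext i (extend (u ∷ []))) f                      ≡⟨ ∑-ext i (extend (u ∷ [])) f ⟩
    ∑ (extend (u ∷ [])) (λ w → ∑ (ext i (w ∷ [])) f)   ≡⟨ ∑-map (_∷ u ∷ []) (nbrs u) _ ⟩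
    _                                                  ∎
    where open ≡-Reasoning

  module _ {q} (regular : Regular G (suc q)) where

    -- Once a walk has an edge, one of the `suc q` neighbours of its end is forbidden, which leaves
    -- `q` continuations.
    length-ext-edge : ∀ {u a} i → u ∼ a → length (ext i ((a ∷ u ∷ []) ∷ [])) ≡ q ^ i
    length-ext-edge zero    u∼a = refl
    length-ext-edge {u} {a} (suc i) u∼a = begin
      length (concatMap extend ws)   ≡⟨ length-concatMap extend ws ⟩
      ∑ ws (length ∘ extend)         ≡⟨ ∑-cong ws (λ {w} w∈ → q-extensions (subst (λ j → Walk u j w) (+-comm i 1) (ext-walk i (edge-walk u∼a) w∈))) ⟩
      ∑ ws (const q)                 ≡⟨ ∑-const ws q ⟩
      length ws * q                  ≡⟨ cong (_* q) (length-ext-edge i u∼a) ⟩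
      q ^ i * q                      ≡⟨ *-comm (q ^ i) q ⟩
      q ^ suc i                      ∎
      where
      open ≡-Reasoning
      ws = ext i ((a ∷ u ∷ []) ∷ [])
      q-extensions : ∀ {w j} → Walk u (suc j) w → length (extend w) ≡ q
      q-extensions {x ∷ y ∷ l} (walk nb _ _) = trans (length-map (_∷ x ∷ y ∷ l) (next (x ∷ y ∷ l)))
        (suc-injective (trans (length-next nb) (regular x)))

    length-ext-trivial : ∀ u i → length (ext (suc i) ((u ∷ []) ∷ [])) ≡ suc q * q ^ i
    length-ext-trivial u i = begin
      length (ext (suc i) ((u ∷ []) ∷ []))                            ≡⟨ ∑-1 (ext (suc i) ((u ∷ []) ∷ [])) ⟨
      ∑ (ext (suc i) ((u ∷ []) ∷ [])) (const 1)                       ≡⟨ ∑-ext-trivial i u (const 1) ⟩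
      ∑ (nbrs u) (λ a → ∑ (ext i ((a ∷ u ∷ []) ∷ [])) (const 1))      ≡⟨ ∑-cong (nbrs u) (λ {a} a∈ → trans (∑-1 (ext i ((a ∷ u ∷ []) ∷ []))) (length-ext-edge i (nbrs-∈ a∈))) ⟩
      ∑ (nbrs u) (const (q ^ i))                                      ≡⟨ ∑-const (nbrs u) (q ^ i) ⟩
      degree G u * q ^ i                                              ≡⟨ cong (_* q ^ i) (regular u) ⟩
      suc q * q ^ i                                                   ∎
      where open ≡-Reasoning

-- Consequences of the girth: short walks are determined by their ends

module Girth {n : ℕ} (G : Graph n) (g : ℕ) (girth : ∀ L c → IsCycle G L c → g ≤ L) where

  open Enumeration G public

  NB⇒unique : ∀ {l} → NB l → length l ≤ g → Unique l
  NB⇒unique {l} nb len = decidable-stable (unique? l) λ ¬u →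
    let L , c , cyc , L< = short-cycle l nb ¬u in <-irrefl refl (<-≤-trans L< (≤-trans len (girth L c cyc)))

  no-return : ∀ {u l} → NB (u ∷ l) → EndsAt u l → ¬ (length (u ∷ l) ≤ g)
  no-return nb e len = Unique[x∷xs]⇒x∉xs (NB⇒unique nb len) (endsAt⇒∈ e)

  -- Where the two walks part, reversing one onto the other closes a short non-backtracking walk.
  walks-agree : ∀ {u x} xs ys → NB (x ∷ xs) → NB (x ∷ ys) → EndsAt u (x ∷ xs) → EndsAt u (x ∷ ys) →
    length (x ∷ xs) + length (x ∷ ys) ≤ suc g → xs ≡ ys
  walks-agree []       []       _  _   _    _         _ = refl
  walks-agree []       (y ∷ ys) _  nb′ here (there e) len = ⊥-elim (no-return nb′ e (ℕ.s≤s⁻¹ len))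
  walks-agree (y ∷ ys) []       nb _   (there e) here len =
    ⊥-elim (no-return nb e (ℕ.s≤s⁻¹ (subst (_≤ suc g) (+-comm (length (y ∷ y ∷ ys)) 1) len)))
  walks-agree {u} {x} (y ∷ xs) (z ∷ ys) nb nb′ (there e) (there e′) len with y ≟ᶠ z
  ... | yes refl = cong (y ∷_) (walks-agree xs ys (NB-tail nb) (NB-tail nb′) e e′
          (≤-trans (n≤1+n _) (≤-trans (n≤1+n _) (subst (_≤ suc g) (cong suc (+-suc (suc (length xs)) (suc (length ys)))) len))))
  -- The joined list contains the shared head `x` only once, which turns the bound `suc g` into `g`.
  ... | no ne with l , eq , el ← ʳ++-endsAt e (there {x = x} e′) =
    ⊥-elim (no-return (subst NB eq (NB-join (y ∷ xs) nb nb′ ne)) el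
      (subst (_≤ g) (trans (sym (length-ʳ++ (y ∷ xs))) (cong length eq)) (ℕ.s≤s⁻¹ len)))

  walk-unique : ∀ {u i j w w′} → Walk u i w → Walk u j w′ → endpoint u w ≡ endpoint u w′ → suc i + suc j ≤ suc g → w ≡ w′
  walk-unique {w = x ∷ xs} {w′ = .x ∷ ys} (walk nb e refl) (walk nb′ e′ refl) refl len =
    cong (x ∷_) (walks-agree xs ys nb nb′ e e′ len)

  -- Dropping `u` leaves a walk from `a` with one edge less. For walks of length h this is what
  -- brings two of them within the range of `walk-unique`.
  ext-edge-snoc : ∀ {u a} i {w} → u ∼ a → w ∈ ext i ((a ∷ u ∷ []) ∷ []) →
    ∃₂ λ x l → w ≡ (x ∷ l) ++ u ∷ [] × Walk a i (x ∷ l)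
  ext-edge-snoc {u} {a} i u∼a w∈ with walk nb _ len ← ext-walk i (edge-walk u∼a) w∈ | snoc i w∈
    where
    snoc : ∀ i {w} → w ∈ ext i ((a ∷ u ∷ []) ∷ []) → ∃₂ λ x l → w ≡ (x ∷ l) ++ u ∷ [] × EndsAt a (x ∷ l)
    snoc zero (here refl) = a , [] , refl , here
    snoc (suc i) w∈ with z , w′ , refl , w′∈ , _ ← ext-suc⁻ i ((a ∷ u ∷ []) ∷ []) w∈
                    with x , l , refl , e ← snoc i w′∈ = z , x ∷ l , refl , there e
  ... | x , l , refl , e = x , l , refl ,
    walk (NB-prefix x l (u ∷ []) nb) e (+-cancelʳ-≡ 1 _ _ (trans (sym (length-++ (x ∷ l))) len))

-- Cycles through a vertex as pairs of walks

length-filter-map : ∀ {A B : Set} {P : B → Set} (P? : Decidable P) (f : A → B) xs →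
  length (filter P? (map f xs)) ≡ length (filter (P? ∘ f) xs)
length-filter-map P? f []       = refl
length-filter-map P? f (x ∷ xs) with P? (f x)
... | yes _ = cong suc (length-filter-map P? f xs)
... | no  _ = length-filter-map P? f xs

length-filter-× : ∀ {A : Set} {P Q : A → Set} (P? : Decidable P) (Q? : Decidable Q) xs →
  length (filter (λ x → P? x ×-dec Q? x) xs) ≡ length (filter Q? (filter P? xs))
length-filter-× P? Q? []       = refl
length-filter-× P? Q? (x ∷ xs) with P? x
... | no  _ = length-filter-× P? Q? xs
... | yes _ with Q? x
...   | yes _ = cong suc (length-filter-× P? Q? xs)
...   | no  _ = length-filter-× P? Q? xs

length-filter-product : ∀ {A B : Set} {P : A × B → Set} (P? : Decidable P) xs ys →
  length (filter P? (cartesianProduct xs ys)) ≡ ∑ xs (λ x → length (filter (λ y → P? (x , y)) ys))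
length-filter-product P? []       ys = refl
length-filter-product P? (x ∷ xs) ys = begin
  length (filter P? (map (x ,_) ys ++ cartesianProduct xs ys))
    ≡⟨ cong length (filter-++ P? (map (x ,_) ys) (cartesianProduct xs ys)) ⟩
  length (filter P? (map (x ,_) ys) ++ filter P? (cartesianProduct xs ys))
    ≡⟨ length-++ (filter P? (map (x ,_) ys)) ⟩
  length (filter P? (map (x ,_) ys)) + length (filter P? (cartesianProduct xs ys))
    ≡⟨ cong₂ _+_ (length-filter-map P? (x ,_) ys) (length-filter-product P? xs ys) ⟩
  _ ∎
  where open ≡-Reasoning

-- A cycle of length g = 2h through u is a pair of distinct walks of length h = h′ + 1 from u with the same end.
module Antipodes {n : ℕ} (G : Graph n) (h′ : ℕ) (3≤g : 3 ≤ 2 * suc h′)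
  (girth : ∀ L c → IsCycle G L c → 2 * suc h′ ≤ L) (u : Fin n) where

  g : ℕ
  g = 2 * suc h′

  open Girth G g girth public

  g≡h+h : g ≡ suc h′ + suc h′
  g≡h+h = cong (suc h′ +_) (+-identityʳ (suc h′))

  Y : List (List V)
  Y = ext (suc h′) ((u ∷ []) ∷ [])

  end : List V → V
  end = endpoint u

  Y-walk : ∀ {w} → w ∈ Y → Walk u (suc h′) w
  Y-walk {w} w∈ = subst (λ i → Walk u i w) (+-identityʳ (suc h′)) (ext-walk (suc h′) (trivial-walk u) w∈)

  Y-unique : Unique Y
  Y-unique = ext-unique (suc h′) ([] ∷ [])

  _≟ʷ_ : (w w′ : List V) → Dec (w ≡ w′)
  _≟ʷ_ = ≡-dec _≟ᶠ_

  Meet? : (p : List V × List V) → Dec (end (proj₂ p) ≡ end (proj₁ p) × proj₂ p ≢ proj₁ p)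
  Meet? (w , w′) = (end w′ ≟ᶠ end w) ×-dec ¬? (w′ ≟ʷ w)

  -- The pairs are ordered: exchanging the walks reverses the cycle, which matches the two
  -- orientations counted by `rootedCycles`.
  pairs : List (List V × List V)
  pairs = filter Meet? (cartesianProduct Y Y)

  pairs⁻ : ∀ {w w′} → (w , w′) ∈ pairs → Walk u (suc h′) w × Walk u (suc h′) w′ × end w′ ≡ end w × w′ ≢ w
  pairs⁻ p with p∈ , eq , ne ← ∈-filter⁻ Meet? {xs = cartesianProduct Y Y} p
           with w∈ , w′∈ ← ∈-cartesianProduct⁻ Y Y p∈ = Y-walk w∈ , Y-walk w′∈ , eq , ne

  pairs⁺ : ∀ {w w′} → Walk u (suc h′) w → Walk u (suc h′) w′ → end w′ ≡ end w → w′ ≢ w → (w , w′) ∈ pairs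
  pairs⁺ W W′ eq ne = ∈-filter⁺ Meet? (∈-cartesianProduct⁺ (ext-complete (suc h′) W) (ext-complete (suc h′) W′)) (eq , ne)

  -- Both lists begin at the common endpoint; `drop 1` keeps it from being listed twice. The result
  -- is a closed walk from `u` to `u`.
  glue : List V × List V → List V
  glue (w , w′) = drop 1 w ʳ++ w′

  glue-injective : ∀ {p p′} → p ∈ pairs → p′ ∈ pairs → glue p ≡ glue p′ → p ≡ p′
  glue-injective {w , w′} {v , v′} p∈ p′∈ eq with pairs⁻ p∈ | pairs⁻ p′∈
  glue-injective {x ∷ xs , .x ∷ xs′} {y ∷ ys , .y ∷ ys′} p∈ p′∈ eq
    | walk _ _ l , _ , refl , _ | walk _ _ l′ , _ , refl , _
    with refl , refl ← ʳ++-injective xs ys eq (suc-injective (trans l (sym l′))) = refl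

  -- Repeating the root at the end gives a rooted cycle the shape of a glued pair, so that the two
  -- can be compared as lists.
  close : Vec V g → List V
  close c = toList c ++ u ∷ []

  RootedCycle? : (c : Vec V g) → Dec (IsCycle G g c × StartsAt c u)
  RootedCycle? c = IsCycle? G g c ×-dec StartsAt? c u

  cycles : List (Vec V g)
  cycles = filter RootedCycle? (allVecs n g)

  close-injective : ∀ {c c′} → close c ≡ close c′ → c ≡ c′
  close-injective {c} {c′} eq = trans (sym (cast-is-id refl c)) (toList-injective refl c c′ (∷ʳ-injectiveˡ (toList c) (toList c′) eq))

  -- Without its last entry the closed walk has `g` vertices, and the girth forces these to be
  -- distinct.
  closed-walk⇒cycle : ∀ {l} → NB (u ∷ l) → EndsAt u l → length l ≡ g →
    ∃ λ c → c ∈ cycles × u ∷ l ≡ close c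
  closed-walk⇒cycle nb e len with c₀ , refl ← endsAt⇒snoc e
    with c@(.u ∷ _) , refl ← toList-surjective (u ∷ c₀) (trans (+-comm 1 (length c₀)) (trans (sym (length-++ c₀)) len)) =
    c , ∈-filter⁺ RootedCycle? (allVecs-complete g c)
      (isCycle-intro c 3≤g (NB⇒unique (NB-prefix u _ (u ∷ []) nb) (≤-reflexive (length-toList c))) (NB⇒Linked nb) , refl)
    , refl

  pair⇒cycle : ∀ {p} → p ∈ pairs → ∃ λ c → c ∈ cycles × glue p ≡ close c
  pair⇒cycle p∈ with pairs⁻ p∈
  pair⇒cycle {x ∷ a ∷ xs , .x ∷ b ∷ ys} p∈ | walk nb (there e) l , walk nb′ e′@(there e″) l′ , refl , ne
    = let ys₀ , eq , e₀ = ʳ++-endsAt e e′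
          c , c∈ , eq′ = closed-walk⇒cycle (subst NB eq (NB-join (a ∷ xs) nb nb′ apart)) e₀ (len eq)
      in c , c∈ , trans eq eq′
    where
    -- A common last step would leave two walks of `h′` edges with the same end; these agree by the
    -- girth, and the pair would not be distinct.
    apart : a ≢ b
    apart refl = ne (cong (λ l → x ∷ a ∷ l) (sym (walks-agree xs ys (NB-tail nb) (NB-tail nb′) e e″
      (≤-trans (≤-reflexive (trans (cong₂ _+_ (suc-injective l) (suc-injective l′)) (sym g≡h+h))) (n≤1+n g)))))
    len : ∀ {l₀} → (a ∷ xs) ʳ++ (x ∷ b ∷ ys) ≡ u ∷ l₀ → length l₀ ≡ g
    len {l₀} eq = suc-injective (begin
      length (u ∷ l₀)                                 ≡⟨ cong length eq ⟨
      length ((a ∷ xs) ʳ++ (x ∷ b ∷ ys))              ≡⟨ length-ʳ++ (a ∷ xs) ⟩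
      length (a ∷ xs) + length (x ∷ b ∷ ys)           ≡⟨ cong₂ _+_ (suc-injective l) l′ ⟩
      suc h′ + suc (suc h′)                           ≡⟨ +-suc (suc h′) (suc h′) ⟩
      suc (suc h′ + suc h′)                           ≡⟨ cong suc g≡h+h ⟨
      suc g                                           ∎)
      where open ≡-Reasoning

  -- Distinct vertices exclude backtracking everywhere but at the final step to `u`, where
  -- `u ∉ x ∷ l` excludes it.
  open-NB : ∀ x l → u ∉ x ∷ l → Unique (x ∷ l) → Linked _∼_ ((x ∷ l) ++ u ∷ []) → NB ((x ∷ l) ++ u ∷ [])
  open-NB x []          u∉ uq (a ∷ _)  = edge a
  open-NB x (y ∷ [])    u∉ uq (a ∷ ln) = step a (λ { refl → u∉ (here refl) }) (open-NB y [] (u∉ ∘ there) (drop-unique uq) ln)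
    where
    drop-unique : ∀ {x : V} {l} → Unique (x ∷ l) → Unique l
    drop-unique (_ ∷ u) = u
  open-NB x (y ∷ z ∷ l) u∉ uq@(_ ∷ uq′) (a ∷ ln) =
    step a (λ { refl → Unique[x∷xs]⇒x∉xs uq (there (here refl)) }) (open-NB y (z ∷ l) (u∉ ∘ there) uq′ ln)

  cycle-NB : ∀ {m} (c : Vec V m) → IsCycle G m c → StartsAt c u → NB (toList c ++ u ∷ [])
  cycle-NB (x ∷ y ∷ z ∷ c) (_ , inj , f , a) refl with lookup-injective⇒unique (x ∷ y ∷ z ∷ c) inj | lookup⇒linked (x ∷ y ∷ z ∷ c) f a
  ... | uq@(_ ∷ uq′) | b ∷ ln = step b (λ { refl → Unique[x∷xs]⇒x∉xs uq (there (here refl)) })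
    (open-NB y (z ∷ toList c) (Unique[x∷xs]⇒x∉xs uq) uq′ ln)
  cycle-NB (x ∷ [])     (s≤s () , _) st
  cycle-NB (x ∷ y ∷ []) (s≤s (s≤s ()) , _) st

  cycle⇒pair : ∀ {c} → c ∈ cycles → ∃ λ p → p ∈ pairs × close c ≡ glue p
  cycle⇒pair {c} c∈ with _ , cyc , st ← ∈-filter⁻ RootedCycle? {xs = allVecs n g} c∈
                    with nb ← cycle-NB c cyc st = split c st nb
    where
    split : (c : Vec V g) → StartsAt c u → NB (close c) → ∃ λ p → p ∈ pairs × close c ≡ glue p
    split c@(.u ∷ c₀) refl nb =
      -- The junction starts at the root with an empty first half and moves `suc h′` places, to the
      -- vertex opposite the root.
      let st , b , rest , eq , nb₁ , nb₂ , ap , l , l′ , e , e′ =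
            NB-split (suc h′) [] single nb tt long here (snoc-endsAt (toList c))
          len₁ = trans l (+-identityʳ (suc h′))
          len₂ = +-cancelˡ-≡ (suc h′) _ _ (trans (sym l′) total)
      in (b ∷ st , b ∷ rest) , pairs⁺ (walk nb₁ e (cong suc len₁)) (walk nb₂ e′ (cong suc len₂)) refl (differ st rest len₁ len₂ ap) , sym eq
      where
      total : length (toList c₀ ++ u ∷ []) ≡ suc h′ + suc h′
      total = trans (length-++ (toList c₀)) (trans (+-comm _ 1) (trans (cong suc (length-toList c₀)) g≡h+h))
      long : suc h′ ≤ length (toList c₀ ++ u ∷ [])
      long = ≤-trans (m≤m+n (suc h′) (suc h′)) (≤-reflexive (sym total))
      differ : ∀ {b} st rest → length st ≡ suc h′ → length rest ≡ suc h′ → Apart st rest → b ∷ rest ≢ b ∷ st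
      differ (_ ∷ _) (_ ∷ _) _ _ ne refl = ne refl

  length-pairs : length pairs ≡ rootedCycles G g u
  length-pairs = begin
    length pairs              ≡⟨ length-map glue pairs ⟨
    length (map glue pairs)   ≡⟨ ↭-length same ⟩
    length (map close cycles) ≡⟨ length-map close cycles ⟩
    length cycles             ∎
    where
    open ≡-Reasoning
    to : ∀ {l} → l ∈ map glue pairs → l ∈ map close cycles
    to l∈ with p , p∈ , refl ← ∈-map⁻ glue l∈ with c , c∈ , eq ← pair⇒cycle p∈ =
      subst (_∈ map close cycles) (sym eq) (∈-map⁺ close c∈)
    from : ∀ {l} → l ∈ map close cycles → l ∈ map glue pairs
    from l∈ with c , c∈ , refl ← ∈-map⁻ close l∈ with p , p∈ , eq ← cycle⇒pair c∈ =
      subst (_∈ map glue pairs) (sym eq) (∈-map⁺ glue p∈)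
    same : map glue pairs ↭ map close cycles
    same = unique-set⇒↭
      (map-unique glue-injective (Unique.filter⁺ Meet? (Unique.cartesianProduct⁺ Y-unique Y-unique)))
      (Unique.map⁺ close-injective (Unique.filter⁺ RootedCycle? (allVecs-unique n g)))
      to from

  -- t x is the number of non-backtracking walks of length h from u to x.
  t : V → ℕ
  t = mult _≟ᶠ_ (map end Y)

  -- Among the walks that end where `w` does, one is `w` itself and the others are its partners in
  -- `pairs`.
  t-end : ∀ {w} → w ∈ Y → t (end w) ≡ suc (length (filter (λ w′ → Meet? (w , w′)) Y))
  t-end {w} w∈ = begin
    t (end w)                                                ≡⟨ mult-filter _≟ᶠ_ end Y (end w) ⟩
    length Yₓ                                                ≡⟨ length-remove _≟ʷ_ (Unique.filter⁺ same? Y-unique) (∈-filter⁺ same? w∈ refl) ⟨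
    suc (length (filter (λ w′ → ¬? (w′ ≟ʷ w)) Yₓ))           ≡⟨ cong suc (length-filter-× same? (λ w′ → ¬? (w′ ≟ʷ w)) Y) ⟨
    suc (length (filter (λ w′ → Meet? (w , w′)) Y))          ∎
    where
    open ≡-Reasoning
    same? = λ w′ → end w′ ≟ᶠ end w
    Yₓ = filter same? Y

  -- The sum of squares counts ordered pairs of walks with a common end: the diagonal gives
  -- `length Y`, the rest gives `pairs`.
  ∑-t² : ∑ (allFin n) (λ x → t x * t x) ≡ length Y + rootedCycles G g u
  ∑-t² = begin
    ∑ (allFin n) (λ x → t x * t x)                                           ≡⟨ ∑-mult _≟ᶠ_ t (map end Y) (Unique.allFin⁺ n) ∈-allFin ⟩
    ∑ (map end Y) t                                                          ≡⟨ ∑-map end Y t ⟩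
    ∑ Y (t ∘ end)                                                            ≡⟨ ∑-cong Y t-end ⟩
    ∑ Y (λ w → 1 + length (filter (λ w′ → Meet? (w , w′)) Y))                ≡⟨ ∑-+ Y (const 1) _ ⟩
    ∑ Y (const 1) + ∑ Y (λ w → length (filter (λ w′ → Meet? (w , w′)) Y))    ≡⟨ cong₂ _+_ (∑-1 Y) (sym (length-filter-product Meet? Y Y)) ⟩
    length Y + length pairs                                                  ≡⟨ cong (length Y +_) length-pairs ⟩
    length Y + rootedCycles G g u                                            ∎
    where open ≡-Reasoning

-- The tree around an edge and the inequality for one edge

geometric : ℕ → ℕ → ℕ
geometric q zero    = 0
geometric q (suc i) = geometric q i + q ^ i

m≤1⇒m*m≡m : ∀ {m} → m ≤ 1 → m * m ≡ m
m≤1⇒m*m≡m z≤n       = refl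
m≤1⇒m*m≡m (s≤s z≤n) = refl

module Counting {n : ℕ} (G : Graph n) (h′ : ℕ) (3≤g : 3 ≤ 2 * suc h′)
  (girth : ∀ L c → IsCycle G L c → 2 * suc h′ ≤ L) (u : Fin n) (q : ℕ) (regular : Regular G (suc q)) where

  open Antipodes G h′ 3≤g girth u public
  open import Data.List.Membership.DecPropositional {A = V} _≟ᶠ_ using (_∈?_)

  -- Walks are listed instead of vertices: they are counted by their continuations, and the girth
  -- makes endpoints injective on those with at most `h′` edges.
  ball : ℕ → List (List V)
  ball zero    = ext 0 ((u ∷ []) ∷ [])
  ball (suc i) = ext (suc i) ((u ∷ []) ∷ []) ++ ball i

  ball-walk : ∀ i {w} → w ∈ ball i → ∃ λ j → j ≤ i × Walk u j w
  ball-walk zero    (here refl) = 0 , z≤n , trivial-walk u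
  ball-walk (suc i) {w} w∈ with ∈-++⁻ (ext (suc i) ((u ∷ []) ∷ [])) w∈
  ... | inj₁ w∈′ = suc i , ≤-refl , subst (λ j → Walk u j w) (+-identityʳ (suc i)) (ext-walk (suc i) (trivial-walk u) w∈′)
  ... | inj₂ w∈′ with j , j≤i , W ← ball-walk i w∈′ = j , m≤n⇒m≤1+n j≤i , W

  walk-length-unique : ∀ {i j w} → Walk u i w → Walk u j w → i ≡ j
  walk-length-unique (walk _ _ l) (walk _ _ l′) = suc-injective (trans (sym l) l′)

  ball-unique : ∀ i → Unique (ball i)
  ball-unique zero    = [] ∷ []
  ball-unique (suc i) = Unique.++⁺ (ext-unique (suc i) ([] ∷ [])) (ball-unique i) λ (w∈ , w∈′) →
    let j , j≤i , W = ball-walk i w∈′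
        i≡j = walk-length-unique (ext-walk (suc i) (trivial-walk u) w∈) W
    in <-irrefl (trans (sym i≡j) (+-identityʳ (suc i))) (s≤s j≤i)

  -- The added `q ^ i` is one branch at distance `i + 1`. With it the ball becomes the tree around
  -- an edge: two `q`-ary trees with `i + 1` levels each.
  length-ball : ∀ i → length (ball i) + q ^ i ≡ 2 * geometric q (suc i)
  length-ball zero    = refl
  length-ball (suc i) = begin
    length (ext (suc i) ((u ∷ []) ∷ []) ++ ball i) + q * q ^ i
      ≡⟨ cong (_+ q * q ^ i) (trans (length-++ (ext (suc i) ((u ∷ []) ∷ []))) (cong (_+ length (ball i)) (length-ext-trivial regular u i))) ⟩
    suc q * q ^ i + length (ball i) + q * q ^ i    ≡⟨ regroup (q ^ i) (q * q ^ i) (length (ball i)) ⟩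
    length (ball i) + q ^ i + 2 * (q * q ^ i)      ≡⟨ cong (_+ 2 * (q * q ^ i)) (length-ball i) ⟩
    2 * geometric q (suc i) + 2 * (q * q ^ i)      ≡⟨ *-distribˡ-+ 2 (geometric q (suc i)) (q * q ^ i) ⟨
    2 * geometric q (suc (suc i))                  ∎
    where
    open ≡-Reasoning
    regroup : ∀ a b l → a + b + l + b ≡ l + a + 2 * b
    regroup = solve-∀

  branch : V → List (List V)
  branch v = ext h′ ((v ∷ u ∷ []) ∷ [])

  branch-walk : ∀ {v w} → u ∼ v → w ∈ branch v → Walk u (suc h′) w
  branch-walk {w = w} u∼v w∈ = subst (λ j → Walk u j w) (+-comm h′ 1) (ext-walk h′ (edge-walk u∼v) w∈)

  2h≤1+g : suc h′ + suc h′ ≤ suc g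
  2h≤1+g = ≤-trans (≤-reflexive (sym g≡h+h)) (n≤1+n g)

  branch-end-injective : ∀ {v w w′} → u ∼ v → w ∈ branch v → w′ ∈ branch v → end w ≡ end w′ → w ≡ w′
  branch-end-injective u∼v w∈ w′∈ eq with ext-edge-snoc h′ u∼v w∈ | ext-edge-snoc h′ u∼v w′∈
  ... | x , l , refl , W | x′ , l′ , refl , W′ = cong (_++ u ∷ []) (walk-unique W W′ eq 2h≤1+g)

  -- The two lists have at most `suc h′` and `suc (suc h′)` entries, together at most `suc g`,
  -- exactly the limit of `walk-unique`.
  short-long : ∀ {w w′} → w ∈ ball h′ → Walk u (suc h′) w′ → end w ≢ end w′
  short-long w∈ W′ eq with j , j≤ , W ← ball-walk h′ w∈
    with refl ← walk-unique W W′ eq (≤-trans (+-monoˡ-≤ (suc (suc h′)) (s≤s j≤)) (≤-reflexive (trans (+-suc (suc h′) (suc h′)) (cong suc (sym g≡h+h)))))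
    = <-irrefl (walk-length-unique W W′) (s≤s j≤)

  inner : V → List (List V)
  inner v = ball h′ ++ branch v

  inner-end-injective : ∀ {v w w′} → u ∼ v → w ∈ inner v → w′ ∈ inner v → end w ≡ end w′ → w ≡ w′
  inner-end-injective u∼v w∈ w′∈ eq with ∈-++⁻ (ball h′) w∈ | ∈-++⁻ (ball h′) w′∈
  ... | inj₁ p | inj₁ p′ with i , i≤ , W ← ball-walk h′ p | j , j≤ , W′ ← ball-walk h′ p′ =
    walk-unique W W′ eq (≤-trans (+-mono-≤ (s≤s i≤) (s≤s j≤)) 2h≤1+g)
  ... | inj₁ p | inj₂ p′ = ⊥-elim (short-long p (branch-walk u∼v p′) eq)
  ... | inj₂ p | inj₁ p′ = ⊥-elim (short-long p′ (branch-walk u∼v p) (sym eq))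
  ... | inj₂ p | inj₂ p′ = branch-end-injective u∼v p p′ eq

  tree : V → List V
  tree v = map end (inner v)

  tree-unique : ∀ {v} → u ∼ v → Unique (tree v)
  tree-unique u∼v = map-unique (inner-end-injective u∼v)
    (Unique.++⁺ (ball-unique h′) (ext-unique h′ ([] ∷ []))
      (λ (w∈ , w∈′) → short-long w∈ (branch-walk u∼v w∈′) refl))

  outside? : ∀ v x → Dec (x ∉ tree v)
  outside? v x = ¬? (x ∈? tree v)

  rest : V → List V
  rest v = filter (outside? v) (allFin n)

  tree++rest↭allFin : ∀ {v} → u ∼ v → tree v ++ rest v ↭ allFin n
  tree++rest↭allFin {v} u∼v = unique-set⇒↭
    (Unique.++⁺ (tree-unique u∼v) (Unique.filter⁺ (outside? v) (Unique.allFin⁺ n))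
      (λ (x∈ , x∈′) → proj₂ (∈-filter⁻ (outside? v) {xs = allFin n} x∈′) x∈))
    (Unique.allFin⁺ n) (λ {x} _ → ∈-allFin x) from
    where
    from : ∀ {x} → x ∈ allFin n → x ∈ tree v ++ rest v
    from {x} x∈ with x ∈? tree v
    ... | yes x∈tree = ∈-++⁺ˡ x∈tree
    ... | no  x∉tree = ∈-++⁺ʳ (tree v) (∈-filter⁺ (outside? v) x∈ x∉tree)

  length-tree : ∀ {v} → u ∼ v → length (tree v) ≡ 2 * geometric q (suc h′)
  length-tree {v} u∼v = begin
    length (tree v)                         ≡⟨ length-map end (inner v) ⟩
    length (inner v)                     ≡⟨ length-++ (ball h′) ⟩
    length (ball h′) + length (branch v) ≡⟨ cong (length (ball h′) +_) (length-ext-edge regular h′ u∼v) ⟩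
    length (ball h′) + q ^ h′            ≡⟨ length-ball h′ ⟩
    2 * geometric q (suc h′)             ∎
    where open ≡-Reasoning

  length-rest : ∀ {v} → u ∼ v → 2 * geometric q (suc h′) + length (rest v) ≡ n
  length-rest {v} u∼v = begin
    2 * geometric q (suc h′) + length (rest v)  ≡⟨ cong (_+ length (rest v)) (length-tree u∼v) ⟨
    length (tree v) + length (rest v)              ≡⟨ length-++ (tree v) ⟨
    length (tree v ++ rest v)                      ≡⟨ ↭-length (tree++rest↭allFin u∼v) ⟩
    length (allFin n)                           ≡⟨ length-tabulate (λ i → i) ⟩
    n                                           ∎
    where open ≡-Reasoning

  L : V → List V
  L v = map end (branch v)

  -- P v x and p v x split t x according to whether the walk starts with v or not.
  P : V → V → ℕ
  P v = mult _≟ᶠ_ (L v)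

  P≤1 : ∀ {v} → u ∼ v → ∀ x → P v x ≤ 1
  P≤1 u∼v = mult≤1 _≟ᶠ_ (map-unique (branch-end-injective u∼v) (ext-unique h′ ([] ∷ [])))

  t-branches : ∀ x → t x ≡ ∑ (nbrs u) (λ v → P v x)
  t-branches x = begin
    ∑ (map end Y) δₓ                            ≡⟨ ∑-map end Y δₓ ⟩
    ∑ Y (δₓ ∘ end)                              ≡⟨ ∑-ext-trivial h′ u (δₓ ∘ end) ⟩
    ∑ (nbrs u) (λ v → ∑ (branch v) (δₓ ∘ end))  ≡⟨ ∑-cong (nbrs u) (λ {v} _ → sym (∑-map end (branch v) δₓ)) ⟩
    ∑ (nbrs u) (λ v → P v x)                    ∎
    where
    open ≡-Reasoning
    δₓ : V → ℕ
    δₓ y = δ _≟ᶠ_ y x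

  p : V → V → ℕ
  p v x = t x ∸ P v x

  -- `P v x` is one of the summands of `t x`, so the subtraction in `p` is never truncated.
  p+P : ∀ {v} → u ∼ v → ∀ x → p v x + P v x ≡ t x
  p+P {v} u∼v x = m∸n+n≡m (subst (P v x ≤_) (sym (t-branches x)) (∑-∈ (λ v → P v x) (∈-nbrs u∼v)))

  -- The number of g-cycles through the edge u v.
  λₑ : V → ℕ
  λₑ v = ∑ (L v) (p v)

  ∑-P : ∀ v f → ∑ (allFin n) (λ x → f x * P v x) ≡ ∑ (L v) f
  ∑-P v f = ∑-mult _≟ᶠ_ f (L v) (Unique.allFin⁺ n) ∈-allFin

  length-L : ∀ {v} → u ∼ v → length (L v) ≡ q ^ h′
  length-L {v} u∼v = trans (length-map end (branch v)) (length-ext-edge regular h′ u∼v)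

  ∑-mult-1 : ∀ ys → ∑ (allFin n) (mult _≟ᶠ_ ys) ≡ length ys
  ∑-mult-1 ys = begin
    ∑ (allFin n) (mult _≟ᶠ_ ys)              ≡⟨ ∑-cong (allFin n) (λ {x} _ → sym (*-identityˡ (mult _≟ᶠ_ ys x))) ⟩
    ∑ (allFin n) (λ x → 1 * mult _≟ᶠ_ ys x)  ≡⟨ ∑-mult _≟ᶠ_ (const 1) ys (Unique.allFin⁺ n) ∈-allFin ⟩
    ∑ ys (const 1)                           ≡⟨ ∑-1 ys ⟩
    length ys                                ∎
    where open ≡-Reasoning

  length-Y : length Y ≡ q ^ h′ + q ^ suc h′
  length-Y = length-ext-trivial regular u h′

  -- Of the `q ^ h′ + q ^ suc h′` walks of length h, the `q ^ h′` that start with `v` are left out.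
  ∑-p : ∀ {v} → u ∼ v → ∑ (allFin n) (p v) ≡ q ^ suc h′
  ∑-p {v} u∼v = +-cancelʳ-≡ (q ^ h′) _ _ (begin
    ∑ (allFin n) (p v) + q ^ h′              ≡⟨ cong (∑ (allFin n) (p v) +_) (trans (∑-mult-1 (L v)) (length-L u∼v)) ⟨
    ∑ (allFin n) (p v) + ∑ (allFin n) (P v)  ≡⟨ ∑-+ (allFin n) (p v) (P v) ⟨
    ∑ (allFin n) (λ x → p v x + P v x)       ≡⟨ ∑-cong (allFin n) (λ {x} _ → p+P u∼v x) ⟩
    ∑ (allFin n) t                           ≡⟨ ∑-mult-1 (map end Y) ⟩
    length (map end Y)                       ≡⟨ length-map end Y ⟩
    length Y                                 ≡⟨ length-Y ⟩
    q ^ h′ + q ^ suc h′                      ≡⟨ +-comm (q ^ h′) _ ⟩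
    q ^ suc h′ + q ^ h′                      ∎)
    where open ≡-Reasoning

  -- As `P` takes only the values 0 and 1, t² = p² + 2pP + P. Summed over all vertices, pP gives λₑ
  -- and P gives `q ^ h′`.
  ∑-p² : ∀ {v} → u ∼ v → ∑ (allFin n) (λ x → p v x * p v x) + 2 * λₑ v ≡ q ^ suc h′ + rootedCycles G g u
  ∑-p² {v} u∼v = +-cancelʳ-≡ (q ^ h′) _ _ (begin
    Q + 2 * λₑ v + q ^ h′
      ≡⟨ cong₂ (λ a b → Q + 2 * a + b) (∑-P v (p v)) (trans (∑-mult-1 (L v)) (length-L u∼v)) ⟨
    Q + 2 * ∑ (allFin n) (λ x → p v x * P v x) + ∑ (allFin n) (P v)
      ≡⟨ cong (λ a → Q + a + ∑ (allFin n) (P v)) (∑-*ˡ (allFin n) 2 (λ x → p v x * P v x)) ⟨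
    Q + ∑ (allFin n) (λ x → 2 * (p v x * P v x)) + ∑ (allFin n) (P v)
      ≡⟨ cong (_+ ∑ (allFin n) (P v)) (∑-+ (allFin n) (λ x → p v x * p v x) (λ x → 2 * (p v x * P v x))) ⟨
    ∑ (allFin n) (λ x → p v x * p v x + 2 * (p v x * P v x)) + ∑ (allFin n) (P v)
      ≡⟨ ∑-+ (allFin n) (λ x → p v x * p v x + 2 * (p v x * P v x)) (P v) ⟨
    ∑ (allFin n) (λ x → p v x * p v x + 2 * (p v x * P v x) + P v x)
      ≡⟨ ∑-cong (allFin n) (λ {x} _ → square x) ⟩
    ∑ (allFin n) (λ x → t x * t x)
      ≡⟨ ∑-t² ⟩
    length Y + rootedCycles G g u
      ≡⟨ cong (_+ rootedCycles G g u) length-Y ⟩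
    q ^ h′ + q ^ suc h′ + rootedCycles G g u
      ≡⟨ trans (+-assoc (q ^ h′) _ _) (+-comm (q ^ h′) _) ⟩
    q ^ suc h′ + rootedCycles G g u + q ^ h′ ∎)
    where
    open ≡-Reasoning
    Q = ∑ (allFin n) (λ x → p v x * p v x)
    binomial : ∀ a b → a * a + 2 * (a * b) + b * b ≡ (a + b) * (a + b)
    binomial = solve-∀
    square : ∀ x → p v x * p v x + 2 * (p v x * P v x) + P v x ≡ t x * t x
    square x = begin
      p v x * p v x + 2 * (p v x * P v x) + P v x          ≡⟨ cong (p v x * p v x + 2 * (p v x * P v x) +_) (m≤1⇒m*m≡m (P≤1 u∼v x)) ⟨
      p v x * p v x + 2 * (p v x * P v x) + P v x * P v x  ≡⟨ binomial (p v x) (P v x) ⟩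
      (p v x + P v x) * (p v x + P v x)                    ≡⟨ cong₂ _*_ (p+P u∼v x) (p+P u∼v x) ⟩
      t x * t x                                            ∎

  -- For each neighbour, t · P = P + p · P because P is 0 or 1. Summing over the neighbours turns
  -- this into t² = t + ∑ pP, and the sum of `t` cancels the diagonal term of `∑-t²`.
  ∑-λₑ : ∑ (nbrs u) λₑ ≡ rootedCycles G g u
  ∑-λₑ = +-cancelˡ-≡ (length Y) _ _ (begin
    length Y + ∑ (nbrs u) λₑ
      ≡⟨ cong (_+ ∑ (nbrs u) λₑ) (trans (sym (length-map end Y)) (sym (∑-mult-1 (map end Y)))) ⟩
    ∑ (allFin n) t + ∑ (nbrs u) λₑ
      ≡⟨ cong (∑ (allFin n) t +_) (trans (∑-cong (nbrs u) (λ {v} _ → sym (∑-P v (p v)))) (∑-swap (nbrs u) (allFin n) (λ v x → p v x * P v x))) ⟩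
    ∑ (allFin n) t + ∑ (allFin n) (λ x → ∑ (nbrs u) (λ v → p v x * P v x))
      ≡⟨ ∑-+ (allFin n) t (λ x → ∑ (nbrs u) (λ v → p v x * P v x)) ⟨
    ∑ (allFin n) (λ x → t x + ∑ (nbrs u) (λ v → p v x * P v x))
      ≡⟨ ∑-cong (allFin n) (λ {x} _ → square x) ⟩
    ∑ (allFin n) (λ x → t x * t x)
      ≡⟨ ∑-t² ⟩
    length Y + rootedCycles G g u ∎)
    where
    open ≡-Reasoning
    distribute : ∀ {v} → u ∼ v → ∀ x → P v x + p v x * P v x ≡ t x * P v x
    distribute {v} u∼v x = begin
      P v x + p v x * P v x          ≡⟨ cong (_+ p v x * P v x) (m≤1⇒m*m≡m (P≤1 u∼v x)) ⟨
      P v x * P v x + p v x * P v x  ≡⟨ *-distribʳ-+ (P v x) (P v x) (p v x) ⟨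
      (P v x + p v x) * P v x        ≡⟨ cong (_* P v x) (trans (+-comm (P v x) (p v x)) (p+P u∼v x)) ⟩
      t x * P v x                    ∎
    square : ∀ x → t x + ∑ (nbrs u) (λ v → p v x * P v x) ≡ t x * t x
    square x = begin
      t x + ∑ (nbrs u) (λ v → p v x * P v x)                        ≡⟨ cong (_+ ∑ (nbrs u) (λ v → p v x * P v x)) (t-branches x) ⟩
      ∑ (nbrs u) (λ v → P v x) + ∑ (nbrs u) (λ v → p v x * P v x)   ≡⟨ ∑-+ (nbrs u) (λ v → P v x) (λ v → p v x * P v x) ⟨
      ∑ (nbrs u) (λ v → P v x + p v x * P v x)                      ≡⟨ ∑-cong (nbrs u) (λ v∈ → distribute (nbrs-∈ v∈) x) ⟩
      ∑ (nbrs u) (λ v → t x * P v x)                                ≡⟨ ∑-*ˡ (nbrs u) (t x) (λ v → P v x) ⟩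
      t x * ∑ (nbrs u) (λ v → P v x)                                ≡⟨ cong (t x *_) (t-branches x) ⟨
      t x * t x                                                     ∎

  t-ball : ∀ {w} → w ∈ ball h′ → t (end w) ≡ 0
  t-ball {w} w∈ = mult-∉ _≟ᶠ_ (map end Y) λ x∈ →
    let w′ , w′∈ , eq = ∈-map⁻ end x∈ in short-long w∈ (Y-walk w′∈) eq

  ∑-L+rest : ∀ {v} → u ∼ v → (f : V → ℕ) → (∀ {w} → w ∈ ball h′ → f (end w) ≡ 0) →
    ∑ (L v) f + ∑ (rest v) f ≡ ∑ (allFin n) f
  ∑-L+rest {v} u∼v f zero-on-ball = begin
    ∑ (L v) f + ∑ (rest v) f                       ≡⟨ cong (_+ ∑ (rest v) f) inner-sum ⟨
    ∑ (tree v) f + ∑ (rest v) f                       ≡⟨ ∑-++ (tree v) f ⟨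
    ∑ (tree v ++ rest v) f                            ≡⟨ ∑-↭ f (tree++rest↭allFin u∼v) ⟩
    ∑ (allFin n) f                                 ∎
    where
    open ≡-Reasoning
    inner-sum : ∑ (tree v) f ≡ ∑ (L v) f
    inner-sum = begin
      ∑ (tree v) f                                        ≡⟨ ∑-map end (inner v) f ⟩
      ∑ (inner v) (f ∘ end)                            ≡⟨ ∑-++ (ball h′) (f ∘ end) ⟩
      ∑ (ball h′) (f ∘ end) + ∑ (branch v) (f ∘ end)   ≡⟨ cong₂ _+_ (trans (∑-cong (ball h′) zero-on-ball) (∑-0 (ball h′))) (sym (∑-map end (branch v) f)) ⟩
      ∑ (L v) f                                        ∎

  -- The coefficient `2 * r + 3` is 2 from `∑-p²` plus `2 * r + 1` from the tangent at the leaves.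
  -- All subtracted terms are moved across, which keeps the counting in ℕ.
  edge-bound : ∀ {v} → u ∼ v → ∀ r → ∃₂ λ S Q → S + λₑ v ≡ q ^ suc h′ × S * S ≤ length (rest v) * Q
    × Q + (2 * r + 3) * λₑ v ≤ rootedCycles G g u + q ^ suc h′ + q ^ h′ * (r * suc r)
  edge-bound {v} u∼v r = ∑ (rest v) (p v) , Q ,
    trans (+-comm (∑ (rest v) (p v)) (λₑ v)) (trans (∑-L+rest u∼v (p v) p-ball) (∑-p u∼v)) ,
    cauchy-schwarz (rest v) (p v) , (begin
      Q + (2 * r + 3) * λₑ v                                    ≡⟨ split Q r (λₑ v) ⟩
      Q + 2 * λₑ v + (2 * r + 1) * λₑ v                         ≤⟨ +-monoʳ-≤ (Q + 2 * λₑ v) (∑-tangent (L v) r (p v)) ⟩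
      Q + 2 * λₑ v + (Qₗ + length (L v) * (r * suc r))          ≡⟨ cong (λ m → Q + 2 * λₑ v + (Qₗ + m * (r * suc r))) (length-L u∼v) ⟩
      Q + 2 * λₑ v + (Qₗ + q ^ h′ * (r * suc r))                ≡⟨ regroup Q (λₑ v) Qₗ (q ^ h′ * (r * suc r)) ⟩
      Qₗ + Q + 2 * λₑ v + q ^ h′ * (r * suc r)                  ≡⟨ cong (λ s → s + 2 * λₑ v + q ^ h′ * (r * suc r)) (∑-L+rest u∼v p² p²-ball) ⟩
      ∑ (allFin n) p² + 2 * λₑ v + q ^ h′ * (r * suc r)         ≡⟨ cong (_+ q ^ h′ * (r * suc r)) (trans (∑-p² u∼v) (+-comm (q ^ suc h′) _)) ⟩
      rootedCycles G g u + q ^ suc h′ + q ^ h′ * (r * suc r)    ∎)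
    where
    open ≤-Reasoning
    p² : V → ℕ
    p² x = p v x * p v x
    Q = ∑ (rest v) p²
    Qₗ = ∑ (L v) p²
    p-ball : ∀ {w} → w ∈ ball h′ → p v (end w) ≡ 0
    p-ball w∈ = n≤0⇒n≡0 (≤-trans (m∸n≤m _ (P v _)) (≤-reflexive (t-ball w∈)))
    p²-ball : ∀ {w} → w ∈ ball h′ → p² (end w) ≡ 0
    p²-ball w∈ = cong₂ _*_ (p-ball w∈) (p-ball w∈)
    split : ∀ Q r l → Q + (2 * r + 3) * l ≡ Q + 2 * l + (2 * r + 1) * l
    split = solve-∀
    regroup : ∀ Q l Qₗ m → Q + 2 * l + (Qₗ + m) ≡ Qₗ + Q + 2 * l + m
    regroup = solve-∀

-- Integers and rationals

-- Opened only here, since +_ makes sections of natural addition ambiguous.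
open import Data.Integer as ℤ using (ℤ; +_; +<+; +≤+)

ℤ→ℚ-toℚᵘ : ∀ i → toℚᵘ (ℤ→ℚ i) ℚᵘ.≃ mkℚᵘ i 0
ℤ→ℚ-toℚᵘ i = ℚP.toℚᵘ-fromℚᵘ (mkℚᵘ i 0)

ℤ→ℚ-mono : ∀ {i j} → i ℤ.≤ j → ℤ→ℚ i ℚ.≤ ℤ→ℚ j
ℤ→ℚ-mono {i} {j} i≤j = ℚP.toℚᵘ-cancel-≤ (begin
  toℚᵘ (ℤ→ℚ i) ≃⟨ ℤ→ℚ-toℚᵘ i ⟩
  mkℚᵘ i 0     ≤⟨ *≤* (subst₂ ℤ._≤_ (sym (ℤP.*-identityʳ i)) (sym (ℤP.*-identityʳ j)) i≤j) ⟩
  mkℚᵘ j 0     ≃⟨ ℤ→ℚ-toℚᵘ j ⟨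
  toℚᵘ (ℤ→ℚ j) ∎)
  where open ℚᵘP.≤-Reasoning

ℤ→ℚ-cancel : ∀ {i j} → ℤ→ℚ i ℚ.≤ ℤ→ℚ j → i ℤ.≤ j
ℤ→ℚ-cancel {i} {j} i≤j = subst₂ ℤ._≤_ (ℤP.*-identityʳ i) (ℤP.*-identityʳ j) (ℚᵘP.drop-*≤* (begin
  mkℚᵘ i 0     ≃⟨ ℤ→ℚ-toℚᵘ i ⟨
  toℚᵘ (ℤ→ℚ i) ≤⟨ ℚP.toℚᵘ-mono-≤ i≤j ⟩
  toℚᵘ (ℤ→ℚ j) ≃⟨ ℤ→ℚ-toℚᵘ j ⟩
  mkℚᵘ j 0     ∎))
  where open ℚᵘP.≤-Reasoning

ℤ→ℚ-+ : ∀ i j → ℤ→ℚ (i ℤ.+ j) ≡ ℤ→ℚ i ℚ.+ ℤ→ℚ j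
ℤ→ℚ-+ i j = ℚP.toℚᵘ-injective (begin
  toℚᵘ (ℤ→ℚ (i ℤ.+ j))               ≈⟨ ℤ→ℚ-toℚᵘ (i ℤ.+ j) ⟩
  mkℚᵘ (i ℤ.+ j) 0                   ≈⟨ *≡* (identity i j) ⟩
  mkℚᵘ i 0 ℚᵘ.+ mkℚᵘ j 0             ≈⟨ ℚᵘP.+-cong (ℤ→ℚ-toℚᵘ i) (ℤ→ℚ-toℚᵘ j) ⟨
  toℚᵘ (ℤ→ℚ i) ℚᵘ.+ toℚᵘ (ℤ→ℚ j)     ≈⟨ ℚP.toℚᵘ-homo-+ (ℤ→ℚ i) (ℤ→ℚ j) ⟨
  toℚᵘ (ℤ→ℚ i ℚ.+ ℤ→ℚ j)             ∎)
  where
  open import Relation.Binary.Reasoning.Setoid ℚᵘP.≃-setoid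
  identity : ∀ i j → (i ℤ.+ j) ℤ.* (+ 1) ≡ (i ℤ.* (+ 1) ℤ.+ j ℤ.* (+ 1)) ℤ.* (+ 1)
  identity = ℤSolver.solve-∀

ℤ→ℚ-* : ∀ i j → ℤ→ℚ (i ℤ.* j) ≡ ℤ→ℚ i ℚ.* ℤ→ℚ j
ℤ→ℚ-* i j = ℚP.toℚᵘ-injective (begin
  toℚᵘ (ℤ→ℚ (i ℤ.* j))               ≈⟨ ℤ→ℚ-toℚᵘ (i ℤ.* j) ⟩
  mkℚᵘ (i ℤ.* j) 0                   ≈⟨ *≡* refl ⟩
  mkℚᵘ i 0 ℚᵘ.* mkℚᵘ j 0             ≈⟨ ℚᵘP.*-cong (ℤ→ℚ-toℚᵘ i) (ℤ→ℚ-toℚᵘ j) ⟨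
  toℚᵘ (ℤ→ℚ i) ℚᵘ.* toℚᵘ (ℤ→ℚ j)     ≈⟨ ℚP.toℚᵘ-homo-* (ℤ→ℚ i) (ℤ→ℚ j) ⟨
  toℚᵘ (ℤ→ℚ i ℚ.* ℤ→ℚ j)             ∎)
  where open import Relation.Binary.Reasoning.Setoid ℚᵘP.≃-setoid

ℤ→ℚ-neg : ∀ i → ℤ→ℚ (ℤ.- i) ≡ ℚ.- ℤ→ℚ i
ℤ→ℚ-neg i = ℚP.toℚᵘ-injective (begin
  toℚᵘ (ℤ→ℚ (ℤ.- i))     ≈⟨ ℤ→ℚ-toℚᵘ (ℤ.- i) ⟩
  ℚᵘ.- mkℚᵘ i 0          ≈⟨ ℚᵘP.-‿cong (ℤ→ℚ-toℚᵘ i) ⟨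
  ℚᵘ.- toℚᵘ (ℤ→ℚ i)      ≈⟨ ℚP.toℚᵘ-homo‿- (ℤ→ℚ i) ⟨
  toℚᵘ (ℚ.- ℤ→ℚ i)       ∎)
  where open import Relation.Binary.Reasoning.Setoid ℚᵘP.≃-setoid

ℤ→ℚ-positive : ∀ {i} → + 0 ℤ.< i → ℚ.Positive (ℤ→ℚ i)
ℤ→ℚ-positive {i} 0<i = ℚ.positive (ℚP.toℚᵘ-cancel-< (begin-strict
  mkℚᵘ (+ 0) 0   <⟨ ℚᵘ.*<* (subst (+ 0 ℤ.<_) (sym (ℤP.*-identityʳ i)) 0<i) ⟩
  mkℚᵘ i 0       ≃⟨ ℤ→ℚ-toℚᵘ i ⟨
  toℚᵘ (ℤ→ℚ i)   ∎))
  where open ℚᵘP.≤-Reasoning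

floor-lower : ∀ p → ℤ→ℚ (floor p) ℚ.≤ p
floor-lower p@(mkℚ n d _) = ℚP.toℚᵘ-cancel-≤ (begin
  toℚᵘ (ℤ→ℚ (floor p)) ≃⟨ ℤ→ℚ-toℚᵘ (floor p) ⟩
  mkℚᵘ (floor p) 0     ≤⟨ *≤* (subst (floor p ℤ.* + suc d ℤ.≤_) (sym (ℤP.*-identityʳ n)) ([n/d]*d≤n n (+ suc d))) ⟩
  toℚᵘ p               ∎)
  where open ℚᵘP.≤-Reasoning

floor-greatest : ∀ p {z} → ℤ→ℚ z ℚ.≤ p → z ℤ.≤ floor p
floor-greatest p@(mkℚ n d _) {z} z≤p = subst (z ℤ.≤_) (ℤP.pred-suc (floor p)) (ℤP.i<j⇒i≤pred[j] (ℤP.*-cancelʳ-<-nonNeg {z} {ℤ.suc (floor p)} (+ suc d) (begin-strict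
  z ℤ.* + suc d                      ≤⟨ cleared ⟩
  n                                  <⟨ n<s[n/ℕd]*d n (suc d) ⟩
  ℤ.suc (n ℤ./ℕ suc d) ℤ.* + suc d   ≡⟨ cong (λ f → ℤ.suc f ℤ.* + suc d) (div-pos-is-/ℕ n (suc d)) ⟨
  ℤ.suc (floor p) ℤ.* + suc d        ∎)))
  where
  cleared : z ℤ.* + suc d ℤ.≤ n
  cleared = subst (z ℤ.* + suc d ℤ.≤_) (ℤP.*-identityʳ n)
    (ℚᵘP.drop-*≤* (ℚᵘP.≤-respˡ-≃ (ℤ→ℚ-toℚᵘ z) (ℚP.toℚᵘ-mono-≤ z≤p)))
  open ℤP.≤-Reasoning

ceiling≡-floor- : ∀ p → ceiling p ≡ ℤ.- floor (ℚ.- p)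
ceiling≡-floor- (mkℚ _ _ _) = refl

ceiling-least : ∀ p {z} → p ℚ.≤ ℤ→ℚ z → ceiling p ℤ.≤ z
ceiling-least p {z} p≤z = begin
  ceiling p              ≡⟨ ceiling≡-floor- p ⟩
  ℤ.- floor (ℚ.- p)      ≤⟨ ℤP.neg-mono-≤ (floor-greatest (ℚ.- p) (subst (ℚ._≤ ℚ.- p) (sym (ℤ→ℚ-neg z)) (ℚP.neg-antimono-≤ p≤z))) ⟩
  ℤ.- (ℤ.- z)            ≡⟨ ℤP.neg-involutive z ⟩
  z                      ∎
  where open ℤP.≤-Reasoning

ceiling-upper : ∀ p → p ℚ.≤ ℤ→ℚ (ceiling p)
ceiling-upper p = begin
  p                              ≡⟨ ⁻¹-involutive ℚP.+-0-group p ⟨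
  ℚ.- (ℚ.- p)                    ≤⟨ ℚP.neg-antimono-≤ (floor-lower (ℚ.- p)) ⟩
  ℚ.- ℤ→ℚ (floor (ℚ.- p))        ≡⟨ ℤ→ℚ-neg (floor (ℚ.- p)) ⟨
  ℤ→ℚ (ℤ.- floor (ℚ.- p))        ≡⟨ cong ℤ→ℚ (ceiling≡-floor- p) ⟨
  ℤ→ℚ (ceiling p)                ∎
  where open ℚP.≤-Reasoning

÷₀-* : ∀ p q .{{_ : ℚ.Positive q}} → (p ÷₀ q) ℚ.* q ≡ p
÷₀-* p q {{q>0}} with q ℚP.≟ 0ℚ
... | yes refl = ⊥-elim (ℚP.<-irrefl refl (ℚP.positive⁻¹ 0ℚ {{q>0}}))
... | no q≢0   = begin
  p ℚ.* (ℚ.1/ q) {{nz}} ℚ.* q      ≡⟨ ℚP.*-assoc p ((ℚ.1/ q) {{nz}}) q ⟩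
  p ℚ.* ((ℚ.1/ q) {{nz}} ℚ.* q)    ≡⟨ cong (p ℚ.*_) (ℚP.*-inverseˡ q {{nz}}) ⟩
  p ℚ.* 1ℚ                         ≡⟨ ℚP.*-identityʳ p ⟩
  p                                ∎
  where
  open ≡-Reasoning
  nz = ℚ.≢-nonZero q≢0

÷₀-≤ : ∀ {p r} q .{{_ : ℚ.Positive q}} → p ℚ.≤ r ℚ.* q → p ÷₀ q ℚ.≤ r
÷₀-≤ {p} {r} q p≤rq = ℚP.*-cancelʳ-≤-pos q (subst (ℚ._≤ r ℚ.* q) (sym (÷₀-* p q)) p≤rq)

≤-÷₀ : ∀ {p r} q .{{_ : ℚ.Positive q}} → r ℚ.* q ℚ.≤ p → r ℚ.≤ p ÷₀ q
≤-÷₀ {p} {r} q rq≤p = ℚP.*-cancelʳ-≤-pos q (subst (r ℚ.* q ℚ.≤_) (sym (÷₀-* p q)) rq≤p)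

ceiling-÷₀-≤ : ∀ i {d z} → + 0 ℤ.< d → i ℤ.≤ z ℤ.* d → ceiling (ℤ→ℚ i ÷₀ ℤ→ℚ d) ℤ.≤ z
ceiling-÷₀-≤ i {d} {z} 0<d i≤zd = ceiling-least (ℤ→ℚ i ÷₀ ℤ→ℚ d)
  (÷₀-≤ (ℤ→ℚ d) {{ℤ→ℚ-positive 0<d}} (subst (ℤ→ℚ i ℚ.≤_) (ℤ→ℚ-* z d) (ℤ→ℚ-mono i≤zd)))

-- Rounding 2λ/k down or up cannot leave an interval with integer ends that contains it, so both
-- candidates lie between the extreme values of λₑ.
candidate-between : ∀ k l {Λ a b} → Λ ∈ ΛCandidates (suc k) l →
  suc k ℕ.* a ℕ.≤ 2 ℕ.* l → 2 ℕ.* l ℕ.≤ suc k ℕ.* b → + a ℤ.≤ Λ × Λ ℤ.≤ + b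
candidate-between k l {Λ} {a} {b} Λ∈ ka≤ ≤kb = between Λ∈
  where
  x : ℚ
  x = ℕ→ℚ (2 ℕ.* l) ÷₀ ℕ→ℚ (suc k)
  pos : ℚ.Positive (ℕ→ℚ (suc k))
  pos = ℤ→ℚ-positive {+ suc k} (+<+ (s≤s z≤n))
  product : ∀ c → ℕ→ℚ (suc k ℕ.* c) ≡ ℕ→ℚ c ℚ.* ℕ→ℚ (suc k)
  product c = trans (cong ℤ→ℚ (trans (cong +_ (*-comm (suc k) c)) (ℤP.pos-* c (suc k)))) (ℤ→ℚ-* (+ c) (+ suc k))
  a≤x : ℕ→ℚ a ℚ.≤ x
  a≤x = ≤-÷₀ (ℕ→ℚ (suc k)) {{pos}} (subst (ℚ._≤ ℕ→ℚ (2 ℕ.* l)) (product a) (ℤ→ℚ-mono (+≤+ ka≤)))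
  x≤b : x ℚ.≤ ℕ→ℚ b
  x≤b = ÷₀-≤ (ℕ→ℚ (suc k)) {{pos}} (subst (ℕ→ℚ (2 ℕ.* l) ℚ.≤_) (product b) (ℤ→ℚ-mono (+≤+ ≤kb)))
  between : Λ ∈ ΛCandidates (suc k) l → + a ℤ.≤ Λ × Λ ℤ.≤ + b
  between (here refl)         = floor-greatest x a≤x , ℤ→ℚ-cancel (ℚP.≤-trans (floor-lower x) x≤b)
  between (there (here refl)) = ℤ→ℚ-cancel (ℚP.≤-trans a≤x (ceiling-upper x)) , ceiling-least x x≤b

-- The hypothesis is Λ²/(2m) - Λ/2 ≤ K with the denominators cleared by 2m.
ceiling-difference : ∀ m Λ K → + 0 ℤ.< + m → Λ ℤ.* Λ ℤ.≤ + 2 ℤ.* + m ℤ.* K ℤ.+ Λ ℤ.* + m →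
  ceiling ((ℤ→ℚ (Λ ℤ.* Λ) ÷₀ ℕ→ℚ (2 ℕ.* m)) ℚ.- (ℤ→ℚ Λ ÷₀ ℕ→ℚ 2)) ℤ.≤ K
ceiling-difference m Λ K 0<m bound = ceiling-least _ (begin
  X ℚ.- Z             ≤⟨ ℚP.+-monoˡ-≤ (ℚ.- Z) X≤ ⟩
  ℤ→ℚ K ℚ.+ Z ℚ.- Z   ≡⟨ ℚP.+-assoc (ℤ→ℚ K) Z (ℚ.- Z) ⟩
  ℤ→ℚ K ℚ.+ (Z ℚ.- Z) ≡⟨ cong (ℤ→ℚ K ℚ.+_) (ℚP.+-inverseʳ Z) ⟩
  ℤ→ℚ K ℚ.+ 0ℚ        ≡⟨ ℚP.+-identityʳ (ℤ→ℚ K) ⟩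
  ℤ→ℚ K               ∎)
  where
  open ℚP.≤-Reasoning
  X = ℤ→ℚ (Λ ℤ.* Λ) ÷₀ ℕ→ℚ (2 ℕ.* m)
  Z = ℤ→ℚ Λ ÷₀ ℕ→ℚ 2
  0<2m : + 0 ℤ.< + (2 ℕ.* m)
  0<2m = +<+ (<-≤-trans (ℤP.drop‿+<+ 0<m) (m≤m+n m _))
  expand : ∀ a b c d → (a ℚ.+ b) ℚ.* (c ℚ.* d) ≡ a ℚ.* (c ℚ.* d) ℚ.+ b ℚ.* c ℚ.* d
  expand a b c d = trans (ℚP.*-distribʳ-+ (c ℚ.* d) a b) (cong (a ℚ.* (c ℚ.* d) ℚ.+_) (sym (ℚP.*-assoc b c d)))
  reorder : ∀ m K → + 2 ℤ.* m ℤ.* K ≡ K ℤ.* (+ 2 ℤ.* m)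
  reorder = ℤSolver.solve-∀
  2m-split : ℕ→ℚ (2 ℕ.* m) ≡ ℤ→ℚ (+ 2) ℚ.* ℤ→ℚ (+ m)
  2m-split = trans (cong ℤ→ℚ (ℤP.pos-* 2 m)) (ℤ→ℚ-* (+ 2) (+ m))
  X≤ : X ℚ.≤ ℤ→ℚ K ℚ.+ Z
  X≤ = ÷₀-≤ (ℕ→ℚ (2 ℕ.* m)) {{ℤ→ℚ-positive 0<2m}} (begin
    ℤ→ℚ (Λ ℤ.* Λ)
      ≤⟨ ℤ→ℚ-mono bound ⟩
    ℤ→ℚ (+ 2 ℤ.* + m ℤ.* K ℤ.+ Λ ℤ.* + m)
      ≡⟨ trans (ℤ→ℚ-+ (+ 2 ℤ.* + m ℤ.* K) (Λ ℤ.* + m)) (cong₂ ℚ._+_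
           (trans (cong ℤ→ℚ (reorder (+ m) K)) (trans (ℤ→ℚ-* K (+ 2 ℤ.* + m)) (cong (ℤ→ℚ K ℚ.*_) (ℤ→ℚ-* (+ 2) (+ m)))))
           (ℤ→ℚ-* Λ (+ m))) ⟩
    ℤ→ℚ K ℚ.* (ℤ→ℚ (+ 2) ℚ.* ℤ→ℚ (+ m)) ℚ.+ ℤ→ℚ Λ ℚ.* ℤ→ℚ (+ m)
      ≡⟨ cong (λ b → ℤ→ℚ K ℚ.* (ℤ→ℚ (+ 2) ℚ.* ℤ→ℚ (+ m)) ℚ.+ b ℚ.* ℤ→ℚ (+ m)) (÷₀-* (ℤ→ℚ Λ) (ℕ→ℚ 2)) ⟨
    ℤ→ℚ K ℚ.* (ℤ→ℚ (+ 2) ℚ.* ℤ→ℚ (+ m)) ℚ.+ Z ℚ.* ℤ→ℚ (+ 2) ℚ.* ℤ→ℚ (+ m)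
      ≡⟨ expand (ℤ→ℚ K) Z (ℤ→ℚ (+ 2)) (ℤ→ℚ (+ m)) ⟨
    (ℤ→ℚ K ℚ.+ Z) ℚ.* (ℤ→ℚ (+ 2) ℚ.* ℤ→ℚ (+ m))
      ≡⟨ cong ((ℤ→ℚ K ℚ.+ Z) ℚ.*_) 2m-split ⟨
    (ℤ→ℚ K ℚ.+ Z) ℚ.* ℕ→ℚ (2 ℕ.* m) ∎)

0≤-* : ∀ {i j} → + 0 ℤ.≤ i → + 0 ℤ.≤ j → + 0 ℤ.≤ i ℤ.* j
0≤-* {+ m} {+ n} _ _ = subst (+ 0 ℤ.≤_) (ℤP.pos-* m n) (+≤+ z≤n)

edge-inequality : ∀ {M l S R Q C} s → S ℕ.+ l ≡ M → S ℕ.* S ℕ.≤ R ℕ.* Q → Q ℕ.+ s ℕ.* l ℕ.≤ C →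
  (+ M ℤ.- + l) ℤ.* (+ M ℤ.- + l) ℤ.≤ + R ℤ.* (+ C ℤ.- + s ℤ.* + l)
edge-inequality {l = l} {S} {R} {Q} {C} s refl S²≤ Q≤ = begin
  (+ (S ℕ.+ l) ℤ.- + l) ℤ.* (+ (S ℕ.+ l) ℤ.- + l) ≡⟨ cong (λ i → (i ℤ.- + l) ℤ.* (i ℤ.- + l)) (ℤP.pos-+ S l) ⟩
  (+ S ℤ.+ + l ℤ.- + l) ℤ.* (+ S ℤ.+ + l ℤ.- + l) ≡⟨ cancel (+ S) (+ l) ⟩
  + S ℤ.* + S                                     ≡⟨ ℤP.pos-* S S ⟨
  + (S ℕ.* S)                                     ≤⟨ +≤+ S²≤ ⟩
  + (R ℕ.* Q)                                     ≡⟨ ℤP.pos-* R Q ⟩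
  + R ℤ.* + Q                                     ≤⟨ ℤP.*-monoˡ-≤-nonNeg (+ R) Q≤′ ⟩
  + R ℤ.* (+ C ℤ.- + s ℤ.* + l)                   ∎
  where
  open ℤP.≤-Reasoning
  cancel : ∀ S l → (S ℤ.+ l ℤ.- l) ℤ.* (S ℤ.+ l ℤ.- l) ≡ S ℤ.* S
  cancel = ℤSolver.solve-∀
  add-sub : ∀ Q x → Q ≡ Q ℤ.+ x ℤ.- x
  add-sub = ℤSolver.solve-∀
  Q≤′ : + Q ℤ.≤ + C ℤ.- + s ℤ.* + l
  Q≤′ = begin
    + Q                                      ≡⟨ add-sub (+ Q) (+ s ℤ.* + l) ⟩
    + Q ℤ.+ + s ℤ.* + l ℤ.- + s ℤ.* + l      ≡⟨ cong (ℤ._- + s ℤ.* + l) (trans (cong (λ i → + Q ℤ.+ i) (sym (ℤP.pos-* s l))) (sym (ℤP.pos-+ Q (s ℕ.* l)))) ⟩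
    + (Q ℕ.+ s ℕ.* l) ℤ.- + s ℤ.* + l        ≤⟨ ℤP.+-monoˡ-≤ (ℤ.- (+ s ℤ.* + l)) (+≤+ Q≤) ⟩
    + C ℤ.- + s ℤ.* + l                      ∎

-- The difference of the two sides is a concave quadratic in x.
interpolate : ∀ M R C s {a b x} → a ℤ.≤ x → x ℤ.≤ b →
  (M ℤ.- a) ℤ.* (M ℤ.- a) ℤ.≤ R ℤ.* (C ℤ.- s ℤ.* a) →
  (M ℤ.- b) ℤ.* (M ℤ.- b) ℤ.≤ R ℤ.* (C ℤ.- s ℤ.* b) →
  (M ℤ.- x) ℤ.* (M ℤ.- x) ℤ.≤ R ℤ.* (C ℤ.- s ℤ.* x)
-- Passing from `a` to `x` changes the difference by `(x - a)` times the negative of the tested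
-- quantity. If that has the wrong sign, the comparison is made with `b`, where the factor is this
-- quantity plus `b - a`.
interpolate M R C s {a} {b} {x} a≤x x≤b at-a at-b with ℤP.≤-total (x ℤ.+ a ℤ.- + 2 ℤ.* M ℤ.+ R ℤ.* s) (+ 0)
... | inj₁ e≤0 = ℤP.0≤i-j⇒j≤i (subst (+ 0 ℤ.≤_) (sym (identity M R C s a x))
    (ℤP.+-mono-≤ (ℤP.i≤j⇒0≤j-i at-a) (0≤-* (ℤP.i≤j⇒0≤j-i a≤x) (ℤP.neg-mono-≤ e≤0))))
  where
  identity : ∀ M R C s a x → R ℤ.* (C ℤ.- s ℤ.* x) ℤ.- (M ℤ.- x) ℤ.* (M ℤ.- x)
    ≡ (R ℤ.* (C ℤ.- s ℤ.* a) ℤ.- (M ℤ.- a) ℤ.* (M ℤ.- a)) ℤ.+ (x ℤ.- a) ℤ.* (ℤ.- (x ℤ.+ a ℤ.- + 2 ℤ.* M ℤ.+ R ℤ.* s))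
  identity = ℤSolver.solve-∀
... | inj₂ 0≤e = ℤP.0≤i-j⇒j≤i (subst (+ 0 ℤ.≤_) (sym (identity M R C s a b x))
    (ℤP.+-mono-≤ (ℤP.i≤j⇒0≤j-i at-b) (0≤-* (ℤP.i≤j⇒0≤j-i x≤b) (ℤP.+-mono-≤ 0≤e (ℤP.i≤j⇒0≤j-i (ℤP.≤-trans a≤x x≤b))))))
  where
  identity : ∀ M R C s a b x → R ℤ.* (C ℤ.- s ℤ.* x) ℤ.- (M ℤ.- x) ℤ.* (M ℤ.- x)
    ≡ (R ℤ.* (C ℤ.- s ℤ.* b) ℤ.- (M ℤ.- b) ℤ.* (M ℤ.- b)) ℤ.+ (b ℤ.- x) ℤ.* ((x ℤ.+ a ℤ.- + 2 ℤ.* M ℤ.+ R ℤ.* s) ℤ.+ (b ℤ.- a))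
  identity = ℤSolver.solve-∀

-- The integral minimum behind the denominator

triangle : ℕ → ℕ
triangle zero    = 0
triangle (suc r) = triangle r ℕ.+ r

-- Identifies `triangle r` as the binomial coefficient C(r, 2), defined without halving.
2triangle : ∀ r → 2 ℕ.* triangle r ℕ.+ r ≡ r ℕ.* r
2triangle zero    = refl
2triangle (suc r) = trans (regroup (triangle r) r) (trans (cong (ℕ._+ (2 ℕ.* r ℕ.+ 1)) (2triangle r)) (square r))
  where
  regroup : ∀ t r → 2 ℕ.* (t ℕ.+ r) ℕ.+ (1 ℕ.+ r) ≡ (2 ℕ.* t ℕ.+ r) ℕ.+ (2 ℕ.* r ℕ.+ 1)
  regroup = solve-∀
  square : ∀ r → r ℕ.* r ℕ.+ (2 ℕ.* r ℕ.+ 1) ≡ (1 ℕ.+ r) ℕ.* (1 ℕ.+ r)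
  square = solve-∀

-- The minimum of ∑ C(cᵢ, 2) over m natural numbers with sum s + r m, where s < m:
-- s of them equal r + 1 and the others equal r.
minPairs : ℕ → ℕ → ℕ → ℕ
minPairs m r s = m ℕ.* triangle r ℕ.+ r ℕ.* s

-- The sides differ by `s * (m ∸ s)`. Divided by 2m, this compares the integral minimum with its
-- real counterpart, where all `m` numbers equal Λ/m.
minPairs-square : ∀ {m s} r → s ℕ.≤ m → (s ℕ.+ r ℕ.* m) ℕ.* (s ℕ.+ r ℕ.* m)
  ℕ.≤ 2 ℕ.* m ℕ.* minPairs m r s ℕ.+ (s ℕ.+ r ℕ.* m) ℕ.* m
minPairs-square {m} {s} r s≤m = begin
  (s ℕ.+ r ℕ.* m) ℕ.* (s ℕ.+ r ℕ.* m)
    ≡⟨ expand s r m ⟩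
  r ℕ.* r ℕ.* (m ℕ.* m) ℕ.+ 2 ℕ.* (r ℕ.* m ℕ.* s) ℕ.+ s ℕ.* s
    ≤⟨ +-monoʳ-≤ _ (*-monoʳ-≤ s s≤m) ⟩
  r ℕ.* r ℕ.* (m ℕ.* m) ℕ.+ 2 ℕ.* (r ℕ.* m ℕ.* s) ℕ.+ s ℕ.* m
    ≡⟨ cong (λ r² → r² ℕ.* (m ℕ.* m) ℕ.+ 2 ℕ.* (r ℕ.* m ℕ.* s) ℕ.+ s ℕ.* m) (2triangle r) ⟨
  (2 ℕ.* triangle r ℕ.+ r) ℕ.* (m ℕ.* m) ℕ.+ 2 ℕ.* (r ℕ.* m ℕ.* s) ℕ.+ s ℕ.* m
    ≡⟨ collect s r m (triangle r) ⟩
  2 ℕ.* m ℕ.* minPairs m r s ℕ.+ (s ℕ.+ r ℕ.* m) ℕ.* m ∎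
  where
  open ≤-Reasoning
  expand : ∀ s r m → (s ℕ.+ r ℕ.* m) ℕ.* (s ℕ.+ r ℕ.* m) ≡ r ℕ.* r ℕ.* (m ℕ.* m) ℕ.+ 2 ℕ.* (r ℕ.* m ℕ.* s) ℕ.+ s ℕ.* s
  expand = solve-∀
  collect : ∀ s r m t → (2 ℕ.* t ℕ.+ r) ℕ.* (m ℕ.* m) ℕ.+ 2 ℕ.* (r ℕ.* m ℕ.* s) ℕ.+ s ℕ.* m
    ≡ 2 ℕ.* m ℕ.* (m ℕ.* t ℕ.+ r ℕ.* s) ℕ.+ (s ℕ.+ r ℕ.* m) ℕ.* m
  collect = solve-∀

-- The tangent bound is attained when only the values `r` and `r + 1` occur, as these are the zeros
-- of (c - r)(c - r - 1); hence an equality.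
minPairs-tangent : ∀ m r s → 2 ℕ.* minPairs m r s ℕ.+ m ℕ.* (r ℕ.* suc r) ≡ 2 ℕ.* r ℕ.* (s ℕ.+ r ℕ.* m)
minPairs-tangent m r s = begin
  2 ℕ.* minPairs m r s ℕ.+ m ℕ.* (r ℕ.* suc r)                             ≡⟨ collect m r s (triangle r) ⟩
  m ℕ.* (2 ℕ.* triangle r ℕ.+ r) ℕ.+ (m ℕ.* (r ℕ.* r) ℕ.+ 2 ℕ.* (r ℕ.* s)) ≡⟨ cong (λ r² → m ℕ.* r² ℕ.+ (m ℕ.* (r ℕ.* r) ℕ.+ 2 ℕ.* (r ℕ.* s))) (2triangle r) ⟩
  m ℕ.* (r ℕ.* r) ℕ.+ (m ℕ.* (r ℕ.* r) ℕ.+ 2 ℕ.* (r ℕ.* s))                ≡⟨ expand m r s ⟩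
  2 ℕ.* r ℕ.* (s ℕ.+ r ℕ.* m)                                              ∎
  where
  open ≡-Reasoning
  collect : ∀ m r s t → 2 ℕ.* (m ℕ.* t ℕ.+ r ℕ.* s) ℕ.+ m ℕ.* (r ℕ.* (1 ℕ.+ r))
    ≡ m ℕ.* (2 ℕ.* t ℕ.+ r) ℕ.+ (m ℕ.* (r ℕ.* r) ℕ.+ 2 ℕ.* (r ℕ.* s))
  collect = solve-∀
  expand : ∀ m r s → m ℕ.* (r ℕ.* r) ℕ.+ (m ℕ.* (r ℕ.* r) ℕ.+ 2 ℕ.* (r ℕ.* s)) ≡ 2 ℕ.* r ℕ.* (s ℕ.+ r ℕ.* m)
  expand = solve-∀

-- Here k − 1 = q and h = h′ + 1.
denom-bound : ∀ q h′ l r s → 0 ℕ.< q ℕ.^ h′ → s ℕ.≤ q ℕ.^ h′ →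
  + (2 ℕ.* l ℕ.+ q ℕ.^ suc h′ ℕ.+ q ℕ.^ h′ ℕ.* (r ℕ.* suc r)) ℤ.- + (2 ℕ.* r ℕ.+ 3) ℤ.* + (s ℕ.+ r ℕ.* q ℕ.^ h′)
    ℤ.≤ denom (suc q) (suc h′) l (+ (s ℕ.+ r ℕ.* q ℕ.^ h′))
denom-bound q h′ l r s 0<m s≤m = begin
  + (2 ℕ.* l ℕ.+ M ℕ.+ m ℕ.* (r ℕ.* suc r)) ℤ.- + (2 ℕ.* r ℕ.+ 3) ℤ.* + Λ
    ≡⟨ cong₂ ℤ._-_ (trans (ℤP.pos-+ (2 ℕ.* l ℕ.+ M) _) (cong (ℤ._+ + (m ℕ.* (r ℕ.* suc r))) (ℤP.pos-+ (2 ℕ.* l) M)))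
         (cong (ℤ._* + Λ) (trans (ℤP.pos-+ (2 ℕ.* r) 3) (cong (ℤ._+ + 3) (ℤP.pos-* 2 r)))) ⟩
  (+ (2 ℕ.* l) ℤ.+ + M ℤ.+ + (m ℕ.* (r ℕ.* suc r))) ℤ.- (+ 2 ℤ.* + r ℤ.+ + 3) ℤ.* + Λ
    ≡⟨ rearrange (+ (2 ℕ.* l)) (+ M) (+ (m ℕ.* (r ℕ.* suc r))) (+ r) (+ Λ) (+ K) ⟩
  (+ (2 ℕ.* l) ℤ.- + 3 ℤ.* + Λ ℤ.+ + M) ℤ.- + 2 ℤ.* + K ℤ.+ ((+ 2 ℤ.* + K ℤ.+ + (m ℕ.* (r ℕ.* suc r))) ℤ.- + 2 ℤ.* + r ℤ.* + Λ)
    ≡⟨ cong (λ i → (+ (2 ℕ.* l) ℤ.- + 3 ℤ.* + Λ ℤ.+ + M) ℤ.- + 2 ℤ.* + K ℤ.+ i) (ℤP.i≡j⇒i-j≡0 tangent-eq) ⟩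
  (+ (2 ℕ.* l) ℤ.- + 3 ℤ.* + Λ ℤ.+ + M) ℤ.- + 2 ℤ.* + K ℤ.+ + 0
    ≡⟨ ℤP.+-identityʳ _ ⟩
  (+ (2 ℕ.* l) ℤ.- + 3 ℤ.* + Λ ℤ.+ + M) ℤ.- + 2 ℤ.* + K
    ≤⟨ ℤP.+-monoʳ-≤ (+ (2 ℕ.* l) ℤ.- + 3 ℤ.* + Λ ℤ.+ + M) (ℤP.neg-mono-≤ (ℤP.*-monoˡ-≤-nonNeg (+ 2) max≤K)) ⟩
  denom (suc q) (suc h′) l (+ Λ) ∎
  where
  open ℤP.≤-Reasoning
  m = q ℕ.^ h′
  M = q ℕ.^ suc h′
  Λ = s ℕ.+ r ℕ.* m
  K = minPairs m r s
  rearrange : ∀ L M c r Λ K → (L ℤ.+ M ℤ.+ c) ℤ.- (+ 2 ℤ.* r ℤ.+ + 3) ℤ.* Λ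
    ≡ (L ℤ.- + 3 ℤ.* Λ ℤ.+ M) ℤ.- + 2 ℤ.* K ℤ.+ ((+ 2 ℤ.* K ℤ.+ c) ℤ.- + 2 ℤ.* r ℤ.* Λ)
  rearrange = ℤSolver.solve-∀
  tangent-eq : + 2 ℤ.* + K ℤ.+ + (m ℕ.* (r ℕ.* suc r)) ≡ + 2 ℤ.* + r ℤ.* + Λ
  tangent-eq = begin-equality
    + 2 ℤ.* + K ℤ.+ + (m ℕ.* (r ℕ.* suc r))   ≡⟨ cong (ℤ._+ + (m ℕ.* (r ℕ.* suc r))) (ℤP.pos-* 2 K) ⟨
    + (2 ℕ.* K) ℤ.+ + (m ℕ.* (r ℕ.* suc r))   ≡⟨ ℤP.pos-+ (2 ℕ.* K) _ ⟨
    + (2 ℕ.* K ℕ.+ m ℕ.* (r ℕ.* suc r))       ≡⟨ cong +_ (minPairs-tangent m r s) ⟩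
    + (2 ℕ.* r ℕ.* Λ)                         ≡⟨ ℤP.pos-* (2 ℕ.* r) Λ ⟩
    + (2 ℕ.* r) ℤ.* + Λ                       ≡⟨ cong (ℤ._* + Λ) (ℤP.pos-* 2 r) ⟩
    + 2 ℤ.* + r ℤ.* + Λ                       ∎
  square-bound : + Λ ℤ.* + Λ ℤ.≤ + 2 ℤ.* + m ℤ.* + K ℤ.+ + Λ ℤ.* + m
  square-bound = begin
    + Λ ℤ.* + Λ                               ≡⟨ ℤP.pos-* Λ Λ ⟨
    + (Λ ℕ.* Λ)                               ≤⟨ +≤+ (minPairs-square r s≤m) ⟩
    + (2 ℕ.* m ℕ.* K ℕ.+ Λ ℕ.* m)             ≡⟨ ℤP.pos-+ (2 ℕ.* m ℕ.* K) (Λ ℕ.* m) ⟩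
    + (2 ℕ.* m ℕ.* K) ℤ.+ + (Λ ℕ.* m)         ≡⟨ cong₂ ℤ._+_ (trans (ℤP.pos-* (2 ℕ.* m) K) (cong (ℤ._* + K) (ℤP.pos-* 2 m))) (ℤP.pos-* Λ m) ⟩
    + 2 ℤ.* + m ℤ.* + K ℤ.+ + Λ ℤ.* + m       ∎
  -- `K` is an integer not below 0 or the rational under the ceiling. The denominator of the theorem
  -- thus subtracts at most `2 K`.
  max≤K : + 0 ℤ.⊔ ceiling ((ℤ→ℚ (+ Λ ℤ.* + Λ) ÷₀ ℕ→ℚ (2 ℕ.* m)) ℚ.- (ℤ→ℚ (+ Λ) ÷₀ ℕ→ℚ 2)) ℤ.≤ + K
  max≤K = ℤP.⊔-lub (+≤+ z≤n) (ceiling-difference m (+ Λ) (+ K) (+<+ 0<m) square-bound)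

-- At ratio k - 1 this identifies `geometric` with the quotient in `mooreTerm`: the division there
-- is exact.
geometric-sum : ∀ q i → geometric (suc q) i ℕ.* q ℕ.+ 1 ≡ suc q ℕ.^ i
geometric-sum q zero    = refl
geometric-sum q (suc i) = trans (regroup (geometric (suc q) i) (suc q ℕ.^ i) q) (cong (ℕ._+ q ℕ.* suc q ℕ.^ i) (geometric-sum q i))
  where
  regroup : ∀ γ p q → (γ ℕ.+ p) ℕ.* q ℕ.+ 1 ≡ γ ℕ.* q ℕ.+ 1 ℕ.+ q ℕ.* p
  regroup = solve-∀

mooreTerm-geometric : ∀ q h → mooreTerm (suc (suc (suc q))) h ≡ ℕ→ℚ (2 ℕ.* geometric (suc (suc q)) h)
mooreTerm-geometric q h = begin
  ℤ→ℚ (+ 2) ℚ.* (ℤ→ℚ (+ (suc (suc q) ℕ.^ h) ℤ.- + 1) ÷₀ ℕ→ℚ (suc q)) ≡⟨ cong (ℤ→ℚ (+ 2) ℚ.*_) quotient ⟩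
  ℤ→ℚ (+ 2) ℚ.* ℕ→ℚ γ                                               ≡⟨ ℤ→ℚ-* (+ 2) (+ γ) ⟨
  ℤ→ℚ (+ 2 ℤ.* + γ)                                                 ≡⟨ cong ℤ→ℚ (ℤP.pos-* 2 γ) ⟨
  ℕ→ℚ (2 ℕ.* γ)                                                     ∎
  where
  open ≡-Reasoning
  γ = geometric (suc (suc q)) h
  pos : ℚ.Positive (ℕ→ℚ (suc q))
  pos = ℤ→ℚ-positive {+ suc q} (+<+ (s≤s z≤n))
  add-sub : ∀ x → x ℤ.+ + 1 ℤ.- + 1 ≡ x
  add-sub = ℤSolver.solve-∀
  numerator : ℤ→ℚ (+ (suc (suc q) ℕ.^ h) ℤ.- + 1) ≡ ℕ→ℚ γ ℚ.* ℕ→ℚ (suc q)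
  numerator = begin
    ℤ→ℚ (+ (suc (suc q) ℕ.^ h) ℤ.- + 1)      ≡⟨ cong (λ p → ℤ→ℚ (+ p ℤ.- + 1)) (geometric-sum (suc q) h) ⟨
    ℤ→ℚ (+ (γ ℕ.* suc q ℕ.+ 1) ℤ.- + 1)      ≡⟨ cong (λ i → ℤ→ℚ (i ℤ.- + 1)) (ℤP.pos-+ (γ ℕ.* suc q) 1) ⟩
    ℤ→ℚ (+ (γ ℕ.* suc q) ℤ.+ + 1 ℤ.- + 1)    ≡⟨ cong ℤ→ℚ (trans (add-sub (+ (γ ℕ.* suc q))) (ℤP.pos-* γ (suc q))) ⟩
    ℤ→ℚ (+ γ ℤ.* + suc q)                    ≡⟨ ℤ→ℚ-* (+ γ) (+ suc q) ⟩
    ℕ→ℚ γ ℚ.* ℕ→ℚ (suc q)                    ∎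
  quotient : ℤ→ℚ (+ (suc (suc q) ℕ.^ h) ℤ.- + 1) ÷₀ ℕ→ℚ (suc q) ≡ ℕ→ℚ γ
  quotient = ℚP.≤-antisym (÷₀-≤ (ℕ→ℚ (suc q)) {{pos}} (ℚP.≤-reflexive numerator))
                          (≤-÷₀ (ℕ→ℚ (suc q)) {{pos}} (ℚP.≤-reflexive (sym numerator)))

-- Assembly: the choice of the edges and of r

vgr-bound : ∀ {n} (G : Graph n) q h′ l → IsVGR G (suc (suc (suc q))) (2 ℕ.* suc h′) l →
  ∃ λ R → 2 ℕ.* geometric (suc (suc q)) (suc h′) ℕ.+ R ≡ n
    × (∀ Λ → Λ ∈ ΛCandidates (suc (suc (suc q))) l → + 0 ℤ.< denom (suc (suc (suc q))) (suc h′) l Λ →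
         fracTerm (suc (suc (suc q))) (suc h′) l Λ ℤ.≤ + R)
vgr-bound {n} G q h′ l (regular , ((c , cyc) , girth) , count) = R , length-rest (nbrs-∈ a∈) , bound
  where
  -- Any vertex would do; the cycle that realises the girth supplies one.
  u = lookup c zero
  open Counting G h′ (proj₁ cyc) girth u (suc (suc q)) regular

  k = suc (suc (suc q))

  0<degree : 0 ℕ.< length (nbrs u)
  0<degree = subst (0 ℕ.<_) (sym (regular u)) (s≤s z≤n)

  light : ∃ λ v → v ∈ nbrs u × length (nbrs u) ℕ.* λₑ v ℕ.≤ ∑ (nbrs u) λₑ
  light = below-average λₑ (nbrs u) 0<degree

  heavy : ∃ λ v → v ∈ nbrs u × ∑ (nbrs u) λₑ ℕ.≤ length (nbrs u) ℕ.* λₑ v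
  heavy = above-average λₑ (nbrs u) 0<degree

  a = proj₁ light
  a∈ = proj₁ (proj₂ light)
  b = proj₁ heavy
  b∈ = proj₁ (proj₂ heavy)

  ∑λₑ≡2l : ∑ (nbrs u) λₑ ≡ 2 ℕ.* l
  ∑λₑ≡2l = trans ∑-λₑ (count u)

  -- The tree around every edge at `u` has the same size, so the value taken at `a` also serves at
  -- `b`; `interpolate` needs a single one.
  R : ℕ
  R = length (rest a)

  m = suc (suc q) ℕ.^ h′
  M = suc (suc q) ℕ.^ suc h′

  instance
    m≢0 : ℕ.NonZero m
    m≢0 = m^n≢0 (suc (suc q)) h′

  at-edge : ∀ r {v} → v ∈ nbrs u → (+ M ℤ.- + λₑ v) ℤ.* (+ M ℤ.- + λₑ v)
    ℤ.≤ + R ℤ.* (+ (2 ℕ.* l ℕ.+ M ℕ.+ m ℕ.* (r ℕ.* suc r)) ℤ.- + (2 ℕ.* r ℕ.+ 3) ℤ.* + λₑ v)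
  at-edge r {v} v∈ =
    let S , Q , eq , S²≤ , Q≤ = edge-bound (nbrs-∈ v∈) r
    in edge-inequality {R = R} {Q} (2 ℕ.* r ℕ.+ 3) eq
         (subst (λ R → S ℕ.* S ℕ.≤ R ℕ.* Q) same-size S²≤)
         (subst (λ L → Q ℕ.+ (2 ℕ.* r ℕ.+ 3) ℕ.* λₑ v ℕ.≤ L ℕ.+ M ℕ.+ m ℕ.* (r ℕ.* suc r)) (count u) Q≤)
    where
    same-size : length (rest v) ≡ R
    same-size = +-cancelˡ-≡ (2 ℕ.* geometric (suc (suc q)) (suc h′)) _ _
      (trans (length-rest (nbrs-∈ v∈)) (sym (length-rest (nbrs-∈ a∈))))

  numer-bound : ∀ Λ → + λₑ a ℤ.≤ Λ → Λ ℤ.≤ + λₑ b → numer k (suc h′) Λ ℤ.≤ + R ℤ.* denom k (suc h′) l Λ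
  -- A negative `Λ` is excluded by the lower bound `λₑ a`.
  numer-bound (+ N) a≤N N≤b = subst (λ N → numer k (suc h′) (+ N) ℤ.≤ + R ℤ.* denom k (suc h′) l (+ N)) (sym division)
    (ℤP.≤-trans
      (interpolate (+ M) (+ R) (+ (2 ℕ.* l ℕ.+ M ℕ.+ m ℕ.* (r ℕ.* suc r))) (+ (2 ℕ.* r ℕ.+ 3))
        (subst (λ N → + λₑ a ℤ.≤ + N) division a≤N) (subst (λ N → + N ℤ.≤ + λₑ b) division N≤b)
        (at-edge r a∈) (at-edge r b∈))
      (ℤP.*-monoˡ-≤-nonNeg (+ R) (denom-bound (suc (suc q)) h′ l r s (ℕ.>-nonZero⁻¹ m) (<⇒≤ (ℕD.m%n<n N m)))))
    where
    -- `r` depends on Λ and not on `a` or `b`: it is the tangent that is sharp at Λ, used at both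
    -- edges.
    r = N ℕ./ m
    s = N ℕ.% m
    division : N ≡ s ℕ.+ r ℕ.* m
    division = ℕD.m≡m%n+[m/n]*n N m

  bound : ∀ Λ → Λ ∈ ΛCandidates k l → + 0 ℤ.< denom k (suc h′) l Λ → fracTerm k (suc h′) l Λ ℤ.≤ + R
  bound Λ Λ∈ 0<d = ceiling-÷₀-≤ (numer k (suc h′) Λ) 0<d (numer-bound Λ (proj₁ between) (proj₂ between))
    where
    between : + λₑ a ℤ.≤ Λ × Λ ℤ.≤ + λₑ b
    between = candidate-between (suc (suc q)) l Λ∈
      (subst₂ (λ d S → d ℕ.* λₑ a ℕ.≤ S) (regular u) ∑λₑ≡2l (proj₂ (proj₂ light)))
      (subst₂ (λ d S → S ℕ.≤ d ℕ.* λₑ b) (regular u) ∑λₑ≡2l (proj₂ (proj₂ heavy)))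

moore-bound : ∀ {n} q h {R} → 2 ℕ.* geometric (suc (suc q)) h ℕ.+ R ≡ n → mooreTerm (suc (suc (suc q))) h ℚ.≤ ℕ→ℚ n
moore-bound {n} q h {R} size = begin
  mooreTerm (suc (suc (suc q))) h  ≡⟨ mooreTerm-geometric q h ⟩
  ℕ→ℚ (2 ℕ.* γ)                    ≤⟨ ℤ→ℚ-mono (+≤+ (subst (2 ℕ.* γ ℕ.≤_) size (m≤m+n (2 ℕ.* γ) R))) ⟩
  ℕ→ℚ n                            ∎
  where
  open ℚP.≤-Reasoning
  γ = geometric (suc (suc q)) h

moore-excess-bound : ∀ {n} q h {R} → 2 ℕ.* geometric (suc (suc q)) h ℕ.+ R ≡ n → ∀ {e} → e ℤ.≤ + R →
  mooreTerm (suc (suc (suc q))) h ℚ.+ ℤ→ℚ e ℚ.≤ ℕ→ℚ n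
moore-excess-bound {n} q h {R} size {e} e≤R = begin
  mooreTerm (suc (suc (suc q))) h ℚ.+ ℤ→ℚ e   ≡⟨ cong (ℚ._+ ℤ→ℚ e) (mooreTerm-geometric q h) ⟩
  ℕ→ℚ (2 ℕ.* γ) ℚ.+ ℤ→ℚ e                     ≤⟨ ℚP.+-monoʳ-≤ (ℕ→ℚ (2 ℕ.* γ)) (ℤ→ℚ-mono e≤R) ⟩
  ℕ→ℚ (2 ℕ.* γ) ℚ.+ ℕ→ℚ R                     ≡⟨ ℤ→ℚ-+ (+ (2 ℕ.* γ)) (+ R) ⟨
  ℤ→ℚ (+ (2 ℕ.* γ) ℤ.+ + R)                   ≡⟨ cong ℤ→ℚ (ℤP.pos-+ (2 ℕ.* γ) R) ⟨
  ℕ→ℚ (2 ℕ.* γ ℕ.+ R)                         ≡⟨ cong ℕ→ℚ size ⟩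
  ℕ→ℚ n                                       ∎
  where
  open ℚP.≤-Reasoning
  γ = geometric (suc (suc q)) h

theorem8 : ∀ {n : ℕ} (G : Graph n) (k g h λ' : ℕ)
    → IsVGR G k g λ' → 3 ≤ k → g ≡ 2 * h
    → (mooreTerm k h ℚ.≤ ℕ→ℚ n)
    × (∀ (Λ : ℤ) → Λ ∈ ΛCandidates k λ' → + 0 ℤ.< denom k h λ' Λ
    → mooreTerm k h ℚ.+ ℤ→ℚ (fracTerm k h λ' Λ) ℚ.≤ ℕ→ℚ n)
-- At `h = 0` the girth would be realised by a cycle of length 0, and there is none.
theorem8 G k g zero λ' (_ , ((_ , ()) , _) , _) 3≤k refl
theorem8 G (suc (suc (suc q))) g (suc h′) λ' vgr (s≤s (s≤s (s≤s z≤n))) refl =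
  let R , size , bound = vgr-bound G q h′ λ' vgr
  in moore-bound q (suc h′) {R} size , λ Λ Λ∈ 0<d → moore-excess-bound q (suc h′) {R} size (bound Λ Λ∈ 0<d)
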